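{- Let $\hat{p}=\{p_n:n\in\omega\}$ with $p_n\in(0,\tfrac12]$ for all $n$, and let ${\cal F}$ be a nonprincipal filter on $\omega$. The following are equivalent: (1) ${\cal F}$ is $\mu_{\hat p}$-measurable; (2) there exists a family $\{{\cal A}_n:n\in\omega\}$ such that (a) each ${\cal A}_n$ consists of finitely many finite subsets of $\omega$; (b) $\bigcup{\cal A}_n\cap\bigcup{\cal A}_m=\emptyset$ whenever $n\neq m$; (c) $\sum_{n=1}^\infty\mu_{\hat p}(\{X\subseteq\omega:\exists a\in{\cal A}_n\ a\subseteq X\})<\infty$; (d) for every $X\in{\cal F}$ there are infinitely many $n$ such that some $a\in{\cal A}_n$ satisfies $a\subseteq X$.
   Context: Subsets of $\omega$ are identified with their characteristic functions, so filters on $\omega$ are subsets of $2^\omega$. $\mu_{\hat p}$ is the product measure on $2^\omega$ with $\mu_{\hat p}(\{x:x(n)=1\})=p_n$ and $\mu_{\hat p}(\{x:x(n)=0\})=1-p_n$. -}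

module Defs where

open import Data.Bool using (Bool; true; false; _∧_)
open import Data.Integer using (+_)
open import Data.List using (List; []; _∷_; concat; length; applyUpTo)
open import Data.List.Relation.Binary.Disjoint.Propositional using (Disjoint)
open import Data.List.Relation.Unary.All using (All)
open import Data.List.Relation.Unary.Any using (Any)
open import Data.Maybe using (Maybe; just; nothing)
open import Data.Nat using (ℕ; zero; suc)
import Data.Nat as ℕ
import Data.Nat.Properties as ℕ
open import Data.Product using (_×_; _,_; ∃-syntax)
open import Data.Rational using (ℚ; 0ℚ; 1ℚ; ½)
import Data.Rational
import Data.Rational as ℚ
import Data.Rational.Properties as ℚ
open import Data.Rational.Solver using (module +-*-Solver)
open import Data.Empty using (⊥)
open import Function.Base using (_∘_)
open import Function.Bundles using (_⇔_)
open import Level using (0ℓ)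
open import Relation.Binary.PropositionalEquality
  using (_≡_; _≢_; refl; sym; trans; cong; subst)
open import Relation.Nullary using (¬_)
open import Relation.Unary using (Pred; _∩_; ∁)

------------------------------------------------------------------------
-- Real numbers: Cauchy sequences of rationals, compared up to _≈ᴿ_.

Cauchy : (ℕ → ℚ) → Set
Cauchy f = ∀ ε → 0ℚ ℚ.< ε →
  ∃[ N ] ∀ m n → N ℕ.≤ m → N ℕ.≤ n → ℚ.∣ f m ℚ.- f n ∣ ℚ.< ε

record ℝ : Set where
  no-eta-equality
  field
    seq    : ℕ → ℚ
    cauchy : Cauchy seq

open ℝ public

infix  4 _≤ᴿ_ _<ᴿ_ _≈ᴿ_
infixl 6 _+ᴿ_ _-ᴿ_
infixl 7 _*ᴿ_

record _≤ᴿ_ (x y : ℝ) : Set where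
  constructor mk≤
  field
    ≤-eventually : ∀ ε → 0ℚ ℚ.< ε →
      ∃[ N ] ∀ n → N ℕ.≤ n → seq x n ℚ.≤ seq y n ℚ.+ ε

record _<ᴿ_ (x y : ℝ) : Set where
  constructor mk<
  field
    gap          : ℚ
    gap>0        : 0ℚ ℚ.< gap
    <-eventually : ∃[ N ] ∀ n → N ℕ.≤ n → seq x n ℚ.+ gap ℚ.≤ seq y n

open _≤ᴿ_ public
open _<ᴿ_ public

_≈ᴿ_ : ℝ → ℝ → Set
x ≈ᴿ y = x ≤ᴿ y × y ≤ᴿ x

module CauchyLemmas where
  open Data.Rational using (_+_; _*_; _-_; -_; ∣_∣; _<_; _≤_; 1/_; Positive)

  open +-*-Solver using (solve; _:=_; _:+_; _:*_; :-_)

  ring₁ : ∀ a b → - a - - b ≡ - (a - b)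
  ring₁ = solve 2 (λ a b → :- a :+ :- (:- b) := :- (a :+ :- b)) refl

  ring₂ : ∀ a b c d → (a + b) - (c + d) ≡ (a - c) + (b - d)
  ring₂ = solve 4 (λ a b c d → (a :+ b) :+ :- (c :+ d) :=
    (a :+ :- c) :+ (b :+ :- d)) refl

  ring₃ : ∀ a b → a ≡ (a - b) + b
  ring₃ = solve 2 (λ a b → a := (a :+ :- b) :+ b) refl

  ring₄ : ∀ a b c d → a * b - c * d ≡ a * (b - d) + d * (a - c)
  ring₄ = solve 4 (λ a b c d → a :* b :+ :- (c :* d) :=
    a :* (b :+ :- d) :+ d :* (a :+ :- c)) refl

  belowˡ : ∀ m n {o} → m ℕ.⊔ n ℕ.≤ o → m ℕ.≤ o
  belowˡ m n = ℕ.≤-trans (ℕ.m≤m⊔n m n)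

  belowʳ : ∀ m n {o} → m ℕ.⊔ n ℕ.≤ o → n ℕ.≤ o
  belowʳ m n = ℕ.≤-trans (ℕ.m≤n⊔m m n)

  half-pos : ∀ {ε} → 0ℚ < ε → 0ℚ < ε * ½
  half-pos {ε} 0<ε = subst (_< ε * ½) (ℚ.*-zeroˡ ½) (ℚ.*-monoˡ-<-pos ½ 0<ε)

  halves : ∀ ε → ε * ½ + ε * ½ ≡ ε
  halves ε = trans (sym (ℚ.*-distribˡ-+ ε ½ ½)) (ℚ.*-identityʳ ε)

  const-cauchy : ∀ q → Cauchy (λ _ → q)
  const-cauchy q ε 0<ε =
    0 , λ _ _ _ _ → subst (_< ε) (sym (cong ∣_∣ (ℚ.+-inverseʳ q))) 0<ε

  neg-cauchy : ∀ f → Cauchy f → Cauchy (-_ ∘ f)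
  neg-cauchy f cf ε 0<ε = let (N , h) = cf ε 0<ε in
    N , λ m n N≤m N≤n → subst (_< ε) (sym (eq (f m) (f n))) (h m n N≤m N≤n)
    where
    eq : ∀ a b → ∣ - a - - b ∣ ≡ ∣ a - b ∣
    eq a b = trans (cong ∣_∣ (ring₁ a b)) (ℚ.∣-p∣≡∣p∣ (a - b))

  +-cauchy : ∀ f g → Cauchy f → Cauchy g → Cauchy (λ n → f n + g n)
  +-cauchy f g cf cg ε 0<ε
    with cf (ε * ½) (half-pos 0<ε) | cg (ε * ½) (half-pos 0<ε)
  ... | M , h | N , k = M ℕ.⊔ N , λ m n p q → begin-strict
    ∣ (f m + g m) - (f n + g n) ∣
      ≡⟨ cong ∣_∣ (ring₂ (f m) (g m) (f n) (g n)) ⟩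
    ∣ (f m - f n) + (g m - g n) ∣
      ≤⟨ ℚ.∣p+q∣≤∣p∣+∣q∣ (f m - f n) (g m - g n) ⟩
    ∣ f m - f n ∣ + ∣ g m - g n ∣
      <⟨ ℚ.+-mono-< (h m n (belowˡ M N p) (belowˡ M N q))
                    (k m n (belowʳ M N p) (belowʳ M N q)) ⟩
    ε * ½ + ε * ½
      ≡⟨ halves ε ⟩
    ε ∎
    where
    open ℚ.≤-Reasoning

  bounded : ∀ f → Cauchy f →
    ∃[ B ] 0ℚ < B × ∃[ N ] ∀ n → N ℕ.≤ n → ∣ f n ∣ ≤ B
  bounded f cf with cf 1ℚ (ℚ.positive⁻¹ 1ℚ)
  ... | N , h = 1ℚ + ∣ f N ∣
              , ℚ.+-mono-<-≤ (ℚ.positive⁻¹ 1ℚ) (ℚ.0≤∣p∣ (f N))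
              , N , λ n N≤n → begin
    ∣ f n ∣
      ≡⟨ cong ∣_∣ (ring₃ (f n) (f N)) ⟩
    ∣ (f n - f N) + f N ∣
      ≤⟨ ℚ.∣p+q∣≤∣p∣+∣q∣ (f n - f N) (f N) ⟩
    ∣ f n - f N ∣ + ∣ f N ∣
      ≤⟨ ℚ.+-monoˡ-≤ ∣ f N ∣ (ℚ.<⇒≤ (h n N N≤n ℕ.≤-refl)) ⟩
    1ℚ + ∣ f N ∣ ∎
    where
    open ℚ.≤-Reasoning

  *-bound : ∀ a d {B δ} → 0ℚ < B → ∣ a ∣ ≤ B → ∣ d ∣ < δ → ∣ a * d ∣ < B * δ
  *-bound a d {B} {δ} 0<B a≤B d<δ = begin-strict
    ∣ a * d ∣      ≡⟨ ℚ.∣p*q∣≡∣p∣*∣q∣ a d ⟩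
    ∣ a ∣ * ∣ d ∣  ≤⟨ ℚ.*-monoʳ-≤-nonNeg ∣ d ∣ {{ℚ.∣-∣-nonNeg d}} a≤B ⟩
    B * ∣ d ∣      <⟨ ℚ.*-monoʳ-<-pos B {{ℚ.positive 0<B}} d<δ ⟩
    B * δ          ∎
    where open ℚ.≤-Reasoning

  share : ∀ {B ε} → 0ℚ < B → 0ℚ < ε → ∃[ δ ] 0ℚ < δ × B * δ ≡ ε
  share {B} {ε} 0<B 0<ε = 1/B * ε
    , subst (_< 1/B * ε) (ℚ.*-zeroʳ 1/B)
        (ℚ.*-monoʳ-<-pos 1/B {{ℚ.1/pos⇒pos B {{B⁺}}}} 0<ε)
    , trans (sym (ℚ.*-assoc B 1/B ε))
        (trans (cong (_* ε) (ℚ.*-inverseʳ B {{ℚ.pos⇒nonZero B {{B⁺}}}}))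
          (ℚ.*-identityˡ ε))
    where
    B⁺ : Positive B
    B⁺ = ℚ.positive 0<B
    1/B : ℚ
    1/B = (1/ B) {{ℚ.pos⇒nonZero B {{B⁺}}}}

  *-close : ∀ a b c d {B C δ} → 0ℚ < B → 0ℚ < C → ∣ a ∣ ≤ B → ∣ d ∣ ≤ C →
    ∣ b - d ∣ < δ → ∣ a - c ∣ < δ → ∣ a * b - c * d ∣ < (B + C) * δ
  *-close a b c d {B} {C} {δ} 0<B 0<C a≤B d≤C b~d a~c = begin-strict
    ∣ a * b - c * d ∣                  ≡⟨ cong ∣_∣ (ring₄ a b c d) ⟩
    ∣ a * (b - d) + d * (a - c) ∣
      ≤⟨ ℚ.∣p+q∣≤∣p∣+∣q∣ (a * (b - d)) (d * (a - c)) ⟩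
    ∣ a * (b - d) ∣ + ∣ d * (a - c) ∣
      <⟨ ℚ.+-mono-< (*-bound a (b - d) 0<B a≤B b~d) (*-bound d (a - c) 0<C d≤C a~c) ⟩
    B * δ + C * δ                      ≡⟨ ℚ.*-distribʳ-+ δ B C ⟨
    (B + C) * δ                        ∎
    where open ℚ.≤-Reasoning

  *-cauchy : ∀ f g → Cauchy f → Cauchy g → Cauchy (λ n → f n * g n)
  *-cauchy f g cf cg ε 0<ε =
    let (B , 0<B , M₁ , f≤B) = bounded f cf
        (C , 0<C , M₂ , g≤C) = bounded g cg
        (δ , 0<δ , eq)       = share (ℚ.+-mono-< 0<B 0<C) 0<ε
        (M₃ , h)             = cf δ 0<δ
        (M₄ , k)             = cg δ 0<δ
        M₁₂ = M₁ ℕ.⊔ M₂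
        M₃₄ = M₃ ℕ.⊔ M₄
    in M₁₂ ℕ.⊔ M₃₄ , λ m n p q → subst (∣ f m * g m - f n * g n ∣ <_) eq
         (*-close (f m) (g m) (f n) (g n) 0<B 0<C
           (f≤B m (belowˡ M₁ M₂ (belowˡ M₁₂ M₃₄ p)))
           (g≤C n (belowʳ M₁ M₂ (belowˡ M₁₂ M₃₄ q)))
           (k m n (belowʳ M₃ M₄ (belowʳ M₁₂ M₃₄ p)) (belowʳ M₃ M₄ (belowʳ M₁₂ M₃₄ q)))
           (h m n (belowˡ M₃ M₄ (belowʳ M₁₂ M₃₄ p)) (belowˡ M₃ M₄ (belowʳ M₁₂ M₃₄ q))))

open CauchyLemmas

fromℚ : ℚ → ℝ
seq    (fromℚ q) _ = q
cauchy (fromℚ q)   = const-cauchy q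

0ᴿ 1ᴿ ½ᴿ : ℝ
0ᴿ = fromℚ 0ℚ
1ᴿ = fromℚ 1ℚ
½ᴿ = fromℚ ½

_+ᴿ_ : ℝ → ℝ → ℝ
seq    (x +ᴿ y) n = seq x n ℚ.+ seq y n
cauchy (x +ᴿ y)   = +-cauchy (seq x) (seq y) (cauchy x) (cauchy y)

_-ᴿ_ : ℝ → ℝ → ℝ
seq    (x -ᴿ y) n = seq x n ℚ.- seq y n
cauchy (x -ᴿ y)   = +-cauchy (seq x) (ℚ.-_ ∘ seq y)
                             (cauchy x) (neg-cauchy (seq y) (cauchy y))

_*ᴿ_ : ℝ → ℝ → ℝ
seq    (x *ᴿ y) n = seq x n ℚ.* seq y n
cauchy (x *ᴿ y)   = *-cauchy (seq x) (seq y) (cauchy x) (cauchy y)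

∑ : (ℕ → ℝ) → ℕ → ℝ
∑ a zero    = 0ᴿ
∑ a (suc N) = ∑ a N +ᴿ a N

-- Only used for series with non-negative terms, where it says that the
-- sum ∑_{n ≥ 0} a n is finite.
SumFinite : (ℕ → ℝ) → Set
SumFinite a = ∃[ b ] ∀ N → ∑ a N ≤ᴿ b

IsInfimum : Pred ℝ 0ℓ → ℝ → Set
IsInfimum S r = (∀ c → S c → r ≤ᴿ c)
              × (∀ l → (∀ c → S c → l ≤ᴿ c) → l ≤ᴿ r)

------------------------------------------------------------------------
-- The Cantor space 2^ω; its points are also the subsets of ω.

2^ω : Set
2^ω = ℕ → Bool

infix 4 _∈ω_ _⊆ω_
infixr 7 _∩ω_

_∈ω_ : ℕ → 2^ω → Set
n ∈ω X = X n ≡ true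

_⊆ω_ : 2^ω → 2^ω → Set
X ⊆ω Y = ∀ n → n ∈ω X → n ∈ω Y

_∩ω_ : 2^ω → 2^ω → 2^ω
(X ∩ω Y) n = X n ∧ Y n

∅ω ω : 2^ω
∅ω _ = false
ω  _ = true

------------------------------------------------------------------------
-- The product measure, by Carathéodory's construction.

-- The basic clopen set [s] = {x : s is an initial segment of x} for
-- `just s`, and the empty set for `nothing`.
Cyl : Set
Cyl = Maybe (List Bool)

⟦_⟧ : Cyl → Pred 2^ω 0ℓ
⟦ nothing ⟧ x = ⊥
⟦ just s  ⟧ x = applyUpTo x (length s) ≡ s

stringWeight : (ℕ → ℝ) → List Bool → ℝ
stringWeight p []          = 1ᴿ
stringWeight p (true  ∷ s) = p 0 *ᴿ stringWeight (p ∘ suc) s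
stringWeight p (false ∷ s) = (1ᴿ -ᴿ p 0) *ᴿ stringWeight (p ∘ suc) s

weight : (ℕ → ℝ) → Cyl → ℝ
weight p nothing  = 0ᴿ
weight p (just s) = stringWeight p s

-- c bounds the total weight of some countable cover of E by cylinders.
CoverBound : (ℕ → ℝ) → Pred 2^ω 0ℓ → Pred ℝ 0ℓ
CoverBound p E c = ∃[ C ] (∀ x → E x → ∃[ i ] ⟦ C i ⟧ x)
                        × (∀ N → ∑ (weight p ∘ C) N ≤ᴿ c)

-- The value r of the outer measure at E.  It is a relation rather than a
-- function because the existence of infima needs excluded middle.  On
-- measurable sets, in particular on clopen ones, this is the measure.
μ[_]_≈_ : (ℕ → ℝ) → Pred 2^ω 0ℓ → ℝ → Set
μ[ p ] E ≈ r = IsInfimum (CoverBound p E) r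

-- Carathéodory measurability; equivalently, measurability for the
-- completion of the product measure on the Borel sets.
Measurable : (ℕ → ℝ) → Pred 2^ω 0ℓ → Set₁
Measurable p E = ∀ (T : Pred 2^ω 0ℓ) r s t →
  μ[ p ] T ≈ r → μ[ p ] (T ∩ E) ≈ s → μ[ p ] (T ∩ ∁ E) ≈ t → r ≈ᴿ s +ᴿ t

------------------------------------------------------------------------
-- Filters

-- Upward closure also makes F invariant under pointwise equality.
record IsFilter (F : Pred 2^ω 0ℓ) : Set where
  field
    whole    : F ω
    proper   : ¬ F ∅ω
    upward   : ∀ {X Y} → X ⊆ω Y → F X → F Y
    ∩-closed : ∀ {X Y} → F X → F Y → F (X ∩ω Y)

Principal : Pred 2^ω 0ℓ → Set
Principal F = ∃[ A ] ∀ X → F X ⇔ A ⊆ω X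

------------------------------------------------------------------------
-- Finite families of finite sets.  Repetitions and order in the lists
-- are irrelevant to everything below.

FinSet : Set
FinSet = List ℕ

FinFamily : Set
FinFamily = List FinSet

⋃ : FinFamily → List ℕ
⋃ = concat

Meets : FinFamily → Pred 2^ω 0ℓ
Meets 𝒜 X = Any (All (_∈ω X)) 𝒜

record IsWitness (p : ℕ → ℝ) (F : Pred 2^ω 0ℓ) (𝒜 : ℕ → FinFamily) : Set where
  field
    disjoint : ∀ n m → n ≢ m → Disjoint (⋃ (𝒜 n)) (⋃ (𝒜 m))
    -- The sum starts at n = 1.
    summable : ∃[ a ] (∀ n → μ[ p ] Meets (𝒜 n) ≈ a n) × SumFinite (a ∘ suc)
    hits     : ∀ X → F X → ∀ N → ∃[ n ] N ℕ.≤ n × Meets (𝒜 n) X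

{-# OPTIONS --safe #-}
-- A filter with a witness is null by the Borel-Cantelli lemma, and null sets
-- are measurable.
--
-- Conversely, let F be measurable.  Suppose some cylinder [u] had more than
-- half of its measure in F.  Choosing the digits of X and Y beyond u as
-- (1,0), (0,1), (0,0) with probabilities p, p, 1 - 2p gives both the
-- distribution of the measure, so a greedy choice keeps X and Y inside F with
-- X ∩ Y finite, and F would be principal.  Hence F takes at most half of
-- every cylinder, so its measure is at most half of itself, that is, zero.
--
-- If F is null, cover it infinitely often by cylinders of finite total weight.
-- Cutting ω into blocks I_j that grow fast enough gives events J_j of tiny
-- probability about the blocks I_j and I_{j+1} such that every X in F
-- satisfies J_j for infinitely many j.  Either F is already caught by the
-- single-block events "the section of J_j at X is heavy", or some X in F is
-- eventually light; then, as F is closed under X ∩ Y and under supersets,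
-- every Y in F falls infinitely often into the sections of J along X, which
-- are single-block events again.  Passing to upward closed interiors of the
-- single-block events yields the families 𝒜_n.

module Submission where

open import Defs
open import Axiom.ExcludedMiddle using (ExcludedMiddle)
open import Data.Bool using (Bool; true; false; _∧_; not; if_then_else_)
open import Data.Empty using (⊥; ⊥-elim)
open import Data.Integer using (+_)
import Data.Integer as ℤ
import Data.Integer.Properties as ℤ
open import Data.List using (List; []; _∷_; _++_; map; drop; length; applyUpTo; fromMaybe)
open import Data.List.Membership.Propositional using (_∈_; lose; find)
import Data.List.Membership.Propositional.Properties as ∈
import Data.List.Properties as List
open import Data.List.Relation.Unary.All using (All; []; _∷_)
open import Data.List.Relation.Unary.Any using (Any; here; there)
import Data.List.Relation.Unary.Any.Properties as Any
open import Data.Maybe using (just; nothing)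
open import Data.Nat using (ℕ; zero; suc)
import Data.Nat as ℕ
import Data.Nat.Coprimality as Coprime
import Data.Nat.Properties as ℕ
open import Data.Product using (_×_; _,_; ∃-syntax; proj₁; proj₂)
open import Data.Rational using (ℚ; mkℚ; 0ℚ; 1ℚ; ½)
import Data.Rational as ℚ
import Data.Rational.Properties as ℚ
open import Data.Rational.Solver using (module +-*-Solver)
import Data.Rational.Unnormalised as ℚᵘ
import Data.Rational.Unnormalised.Properties as ℚᵘ
open import Data.Sum using (_⊎_; inj₁; inj₂; [_,_]′; map₂)
open import Function.Base using (_∘_)
open import Function.Bundles using (_⇔_; mk⇔)
open import Level using (0ℓ)
open import Relation.Binary.Definitions using (tri<; tri≈; tri>)
open import Relation.Binary.PropositionalEquality
  using (_≡_; _≢_; refl; sym; trans; cong; cong₂; subst; subst₂)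
open import Relation.Nullary using (¬_; yes; no; Dec; contradiction)
open import Relation.Unary using (Pred; _∩_; ∁)

open CauchyLemmas using (belowˡ; belowʳ; half-pos; halves; share; bounded)
open +-*-Solver using (solve; con; _:=_; _:+_; _:*_; :-_)

-- Rational numbers

infix 9 _ᵠ
-- Built directly in lowest terms with denominator 1, so that comparisons with other fractions
-- unfold to inequalities between integers.
_ᵠ : ℕ → ℚ
n ᵠ = mkℚ (+ n) 0 (Coprime.sym (Coprime.1-coprimeTo n))

suc-ᵠ : ∀ n → suc n ᵠ ≡ n ᵠ ℚ.+ 1ℚ
suc-ᵠ n = ℚ.toℚᵘ-injective (ℚᵘ.≃-trans (ℚᵘ.*≡* eq) (ℚᵘ.≃-sym (ℚ.toℚᵘ-homo-+ (n ᵠ) 1ℚ)))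
  where
  eq : + suc n ℤ.* + 1 ≡ (+ n ℤ.* + 1 ℤ.+ + 1) ℤ.* + 1
  eq = cong (ℤ._* + 1) (trans (cong +_ (ℕ.+-comm 1 n)) (cong (ℤ._+ + 1) (sym (ℤ.*-identityʳ (+ n)))))

≤-ᵠ : ∀ q → ∃[ n ] q ℚ.≤ n ᵠ
≤-ᵠ q@(mkℚ (+ n) d _) = n , ℚ.*≤* (ℤ.*-monoˡ-≤-nonNeg (+ n) (ℤ.+≤+ (ℕ.s≤s ℕ.z≤n)))
≤-ᵠ q@(mkℚ ℤ.-[1+ n ] d _) = 0 , ℚ.*≤* ℤ.-≤+

-- A positive fraction is at least the inverse of its denominator `suc d`, so this denominator
-- serves as the multiplier.
1≤-ᵠ* : ∀ {ε} → 0ℚ ℚ.< ε → ∃[ n ] 1ℚ ℚ.≤ n ᵠ ℚ.* ε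
1≤-ᵠ* {mkℚ (+ zero) d _} (ℚ.*<* (ℤ.+<+ ()))
1≤-ᵠ* {mkℚ ℤ.-[1+ n ] d _} (ℚ.*<* ())
1≤-ᵠ* {ε@(mkℚ (+ suc a) d _)} _ = suc d , (begin
  1ℚ                  ≡⟨ ℚ.*-inverseʳ (suc d ᵠ) ⟨
  suc d ᵠ ℚ.* 1/d     ≤⟨ ℚ.*-monoˡ-≤-nonNeg (suc d ᵠ) 1/d≤ε ⟩
  suc d ᵠ ℚ.* ε       ∎)
  where
  open ℚ.≤-Reasoning
  1/d : ℚ
  1/d = ℚ.1/ (suc d ᵠ)
  1/d≤ε : 1/d ℚ.≤ ε
  1/d≤ε = ℚ.*≤* (ℤ.*-monoʳ-≤-nonNeg (+ suc d) {+ 1} {+ suc a} (ℤ.+≤+ (ℕ.s≤s ℕ.z≤n)))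

archimedean : ∀ q {ε} → 0ℚ ℚ.< ε → ∃[ n ] q ℚ.≤ n ᵠ ℚ.* ε
archimedean q {ε} 0<ε with share 0<ε (ℚ.positive⁻¹ 1ℚ)
... | δ , 0<δ , εδ≡1 with ≤-ᵠ (q ℚ.* δ)
... | n , qδ≤n = n , (begin
  q                    ≡⟨ ℚ.*-identityʳ q ⟨
  q ℚ.* 1ℚ             ≡⟨ cong (q ℚ.*_) (trans (ℚ.*-comm δ ε) εδ≡1) ⟨
  q ℚ.* (δ ℚ.* ε)      ≡⟨ ℚ.*-assoc q δ ε ⟨
  (q ℚ.* δ) ℚ.* ε      ≤⟨ ℚ.*-monoʳ-≤-nonNeg ε {{ℚ.nonNegative (ℚ.<⇒≤ 0<ε)}} qδ≤n ⟩
  n ᵠ ℚ.* ε            ∎)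
  where open ℚ.≤-Reasoning

-- Order and arithmetic of real numbers

≤-pointwise : ∀ {x y} → (∀ n → seq x n ℚ.≤ seq y n) → x ≤ᴿ y
≤-pointwise {x} {y} h = mk≤ λ ε 0<ε → 0 , λ n _ → begin
  seq x n         ≤⟨ h n ⟩
  seq y n         ≡⟨ ℚ.+-identityʳ (seq y n) ⟨
  seq y n ℚ.+ 0ℚ  ≤⟨ ℚ.+-monoʳ-≤ (seq y n) (ℚ.<⇒≤ 0<ε) ⟩
  seq y n ℚ.+ ε   ∎
  where open ℚ.≤-Reasoning

≤-refl : ∀ {x} → x ≤ᴿ x
≤-refl = ≤-pointwise (λ _ → ℚ.≤-refl)

-- Termwise equality suffices for equality of reals, so the ring solver for rationals proves
-- identities of reals.
ring : ∀ {x y} → (∀ n → seq x n ≡ seq y n) → x ≈ᴿ y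
ring h = ≤-pointwise (ℚ.≤-reflexive ∘ h) , ≤-pointwise (ℚ.≤-reflexive ∘ sym ∘ h)

≤-trans : ∀ {x y z} → x ≤ᴿ y → y ≤ᴿ z → x ≤ᴿ z
≤-trans {x} {y} {z} (mk≤ f) (mk≤ g) = mk≤ λ ε 0<ε →
  let (M , h) = f (ε ℚ.* ½) (half-pos 0<ε)
      (N , k) = g (ε ℚ.* ½) (half-pos 0<ε)
  in M ℕ.⊔ N , λ n le → let open ℚ.≤-Reasoning in begin
    seq x n                                  ≤⟨ h n (belowˡ M N le) ⟩
    seq y n ℚ.+ ε ℚ.* ½                      ≤⟨ ℚ.+-monoˡ-≤ (ε ℚ.* ½) (k n (belowʳ M N le)) ⟩
    (seq z n ℚ.+ ε ℚ.* ½) ℚ.+ ε ℚ.* ½        ≡⟨ ℚ.+-assoc (seq z n) (ε ℚ.* ½) (ε ℚ.* ½) ⟩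
    seq z n ℚ.+ (ε ℚ.* ½ ℚ.+ ε ℚ.* ½)        ≡⟨ cong (seq z n ℚ.+_) (halves ε) ⟩
    seq z n ℚ.+ ε                            ∎

infix  3 _■
infixr 2 _≲⟨_⟩_ _≈⟨_⟩_ _≈⟨_⟨_

_■ : ∀ x → x ≤ᴿ x
_ ■ = ≤-refl

_≲⟨_⟩_ : ∀ x {y z} → x ≤ᴿ y → y ≤ᴿ z → x ≤ᴿ z
_ ≲⟨ h ⟩ k = ≤-trans h k

_≈⟨_⟩_ : ∀ x {y z} → x ≈ᴿ y → y ≤ᴿ z → x ≤ᴿ z
_ ≈⟨ h ⟩ k = ≤-trans (proj₁ h) k

_≈⟨_⟨_ : ∀ x {y z} → y ≈ᴿ x → y ≤ᴿ z → x ≤ᴿ z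
_ ≈⟨ h ⟨ k = ≤-trans (proj₂ h) k

≈-refl : ∀ {x} → x ≈ᴿ x
≈-refl = ≤-refl , ≤-refl

≈-sym : ∀ {x y} → x ≈ᴿ y → y ≈ᴿ x
≈-sym (h , k) = k , h

≈-trans : ∀ {x y z} → x ≈ᴿ y → y ≈ᴿ z → x ≈ᴿ z
≈-trans (h , k) (h′ , k′) = ≤-trans h h′ , ≤-trans k′ k

+-mono : ∀ {x y u v} → x ≤ᴿ y → u ≤ᴿ v → x +ᴿ u ≤ᴿ y +ᴿ v
+-mono {x} {y} {u} {v} (mk≤ f) (mk≤ g) = mk≤ λ ε 0<ε →
  let (M , h) = f (ε ℚ.* ½) (half-pos 0<ε)
      (N , k) = g (ε ℚ.* ½) (half-pos 0<ε)
  in M ℕ.⊔ N , λ n le → let open ℚ.≤-Reasoning in begin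
    seq x n ℚ.+ seq u n
      ≤⟨ ℚ.+-mono-≤ (h n (belowˡ M N le)) (k n (belowʳ M N le)) ⟩
    (seq y n ℚ.+ ε ℚ.* ½) ℚ.+ (seq v n ℚ.+ ε ℚ.* ½)
      ≡⟨ solve 3 (λ a b e → (a :+ e) :+ (b :+ e) := (a :+ b) :+ (e :+ e)) refl (seq y n) (seq v n) (ε ℚ.* ½) ⟩
    (seq y n ℚ.+ seq v n) ℚ.+ (ε ℚ.* ½ ℚ.+ ε ℚ.* ½)      ≡⟨ cong (seq y n ℚ.+ seq v n ℚ.+_) (halves ε) ⟩
    (seq y n ℚ.+ seq v n) ℚ.+ ε                          ∎

+-monoˡ : ∀ {x y} z → x ≤ᴿ y → x +ᴿ z ≤ᴿ y +ᴿ z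
+-monoˡ z h = +-mono h ≤-refl

+-monoʳ : ∀ {x y} z → x ≤ᴿ y → z +ᴿ x ≤ᴿ z +ᴿ y
+-monoʳ z h = +-mono ≤-refl h

+-cong : ∀ {x y u v} → x ≈ᴿ y → u ≈ᴿ v → x +ᴿ u ≈ᴿ y +ᴿ v
+-cong (h , h′) (k , k′) = +-mono h k , +-mono h′ k′

+-identityˡ : ∀ x → 0ᴿ +ᴿ x ≈ᴿ x
+-identityˡ x = ring (λ n → ℚ.+-identityˡ (seq x n))

+-identityʳ : ∀ x → x +ᴿ 0ᴿ ≈ᴿ x
+-identityʳ x = ring (λ n → ℚ.+-identityʳ (seq x n))

+-interchange : ∀ x y u v → (x +ᴿ y) +ᴿ (u +ᴿ v) ≈ᴿ (x +ᴿ u) +ᴿ (y +ᴿ v)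
+-interchange x y u v = ring (λ n → solve 4 (λ a b c d → (a :+ b) :+ (c :+ d) := (a :+ c) :+ (b :+ d)) refl
  (seq x n) (seq y n) (seq u n) (seq v n))

*-distribˡ : ∀ x y z → x *ᴿ (y +ᴿ z) ≈ᴿ x *ᴿ y +ᴿ x *ᴿ z
*-distribˡ x y z = ring (λ n → ℚ.*-distribˡ-+ (seq x n) (seq y n) (seq z n))

*-zeroʳ : ∀ x → x *ᴿ 0ᴿ ≈ᴿ 0ᴿ
*-zeroʳ x = ring (λ n → ℚ.*-zeroʳ (seq x n))

*-zeroˡ : ∀ x → 0ᴿ *ᴿ x ≈ᴿ 0ᴿ
*-zeroˡ x = ring (λ n → ℚ.*-zeroˡ (seq x n))

*-identityˡ : ∀ x → 1ᴿ *ᴿ x ≈ᴿ x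
*-identityˡ x = ring (λ n → ℚ.*-identityˡ (seq x n))

*-identityʳ : ∀ x → x *ᴿ 1ᴿ ≈ᴿ x
*-identityʳ x = ring (λ n → ℚ.*-identityʳ (seq x n))

*-assoc : ∀ x y z → (x *ᴿ y) *ᴿ z ≈ᴿ x *ᴿ (y *ᴿ z)
*-assoc x y z = ring (λ n → ℚ.*-assoc (seq x n) (seq y n) (seq z n))

*-comm : ∀ x y → x *ᴿ y ≈ᴿ y *ᴿ x
*-comm x y = ring (λ n → ℚ.*-comm (seq x n) (seq y n))

≤⇒0≤- : ∀ {x y} → x ≤ᴿ y → 0ᴿ ≤ᴿ y -ᴿ x
≤⇒0≤- {x} {y} h =
  0ᴿ                    ≈⟨ ring (λ n → sym (ℚ.+-inverseʳ (seq x n))) ⟩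
  x -ᴿ x                ≈⟨ ring (λ n → solve 1 (λ a → a :+ :- a := (con 0ℚ :+ :- a) :+ a) refl (seq x n)) ⟩
  (0ᴿ -ᴿ x) +ᴿ x        ≲⟨ +-monoʳ (0ᴿ -ᴿ x) h ⟩
  (0ᴿ -ᴿ x) +ᴿ y
    ≈⟨ ring (λ n → solve 2 (λ a b → (con 0ℚ :+ :- a) :+ b := b :+ :- a) refl (seq x n) (seq y n)) ⟩
  y -ᴿ x                ■

0≤-⇒≤ : ∀ {x y} → 0ᴿ ≤ᴿ y -ᴿ x → x ≤ᴿ y
0≤-⇒≤ {x} {y} h =
  x                 ≈⟨ +-identityˡ x ⟨
  0ᴿ +ᴿ x           ≲⟨ +-monoˡ x h ⟩
  (y -ᴿ x) +ᴿ x     ≈⟨ ring (λ n → sym (CauchyLemmas.ring₃ (seq y n) (seq x n))) ⟩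
  y                 ■

p≤∣p∣ : ∀ p → p ℚ.≤ ℚ.∣ p ∣
p≤∣p∣ p with ℚ.≤-total 0ℚ p
... | inj₁ h = ℚ.≤-reflexive (sym (ℚ.0≤p⇒∣p∣≡p h))
... | inj₂ h = ℚ.≤-trans h (ℚ.0≤∣p∣ p)

-- Two nonnegative factors have a nonnegative product. Otherwise one factor lies between `- δ` and 0
-- while the other has absolute value at most `B`.
neg*-bound : ∀ {a b B δ} → 0ℚ ℚ.≤ δ → ℚ.- δ ℚ.≤ a → ℚ.- δ ℚ.≤ b → ℚ.∣ a ∣ ℚ.≤ B → ℚ.∣ b ∣ ℚ.≤ B →
  ℚ.- (B ℚ.* δ) ℚ.≤ a ℚ.* b
neg*-bound {a} {b} {B} {δ} 0≤δ -δ≤a -δ≤b a≤B b≤B with ℚ.≤-total 0ℚ a | ℚ.≤-total 0ℚ b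
... | inj₁ 0≤a | inj₁ 0≤b = begin
  ℚ.- (B ℚ.* δ)
    ≤⟨ ℚ.neg-antimono-≤ (subst (ℚ._≤ B ℚ.* δ) (ℚ.*-zeroʳ B) (ℚ.*-monoˡ-≤-nonNeg B {{ℚ.nonNegative 0≤B}} 0≤δ)) ⟩
  0ℚ             ≡⟨ ℚ.*-zeroʳ a ⟨
  a ℚ.* 0ℚ       ≤⟨ ℚ.*-monoˡ-≤-nonNeg a {{ℚ.nonNegative 0≤a}} 0≤b ⟩
  a ℚ.* b        ∎
  where
  open ℚ.≤-Reasoning
  0≤B : 0ℚ ℚ.≤ B
  0≤B = ℚ.≤-trans (ℚ.0≤∣p∣ a) a≤B
... | inj₂ a≤0 | _ = begin
  ℚ.- (B ℚ.* δ)          ≡⟨ ℚ.neg-distribʳ-* B δ ⟩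
  B ℚ.* ℚ.- δ            ≤⟨ ℚ.*-monoʳ-≤-nonPos (ℚ.- δ) {{ℚ.nonPositive (ℚ.neg-antimono-≤ 0≤δ)}} b≤B ⟩
  ℚ.∣ b ∣ ℚ.* ℚ.- δ      ≤⟨ ℚ.*-monoˡ-≤-nonNeg ℚ.∣ b ∣ {{ℚ.∣-∣-nonNeg b}} -δ≤a ⟩
  ℚ.∣ b ∣ ℚ.* a          ≤⟨ ℚ.*-monoʳ-≤-nonPos a {{ℚ.nonPositive a≤0}} (p≤∣p∣ b) ⟩
  b ℚ.* a                ≡⟨ ℚ.*-comm b a ⟩
  a ℚ.* b                ∎
  where
  open ℚ.≤-Reasoning
... | inj₁ 0≤a | inj₂ b≤0 = begin
  ℚ.- (B ℚ.* δ)          ≡⟨ ℚ.neg-distribʳ-* B δ ⟩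
  B ℚ.* ℚ.- δ            ≤⟨ ℚ.*-monoʳ-≤-nonPos (ℚ.- δ) {{ℚ.nonPositive (ℚ.neg-antimono-≤ 0≤δ)}} a≤B ⟩
  ℚ.∣ a ∣ ℚ.* ℚ.- δ      ≡⟨ cong (ℚ._* ℚ.- δ) (ℚ.0≤p⇒∣p∣≡p 0≤a) ⟩
  a ℚ.* ℚ.- δ            ≤⟨ ℚ.*-monoˡ-≤-nonNeg a {{ℚ.nonNegative 0≤a}} -δ≤b ⟩
  a ℚ.* b                ∎
  where open ℚ.≤-Reasoning

move-ε : ∀ {a ε} → 0ℚ ℚ.≤ a ℚ.+ ε → ℚ.- ε ℚ.≤ a
move-ε {a} {ε} h = subst₂ ℚ._≤_ (ℚ.+-identityˡ (ℚ.- ε))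
  (solve 2 (λ a e → (a :+ e) :+ :- e := a) refl a ε) (ℚ.+-monoˡ-≤ (ℚ.- ε) h)

unmove-ε : ∀ {a ε} → ℚ.- ε ℚ.≤ a → 0ℚ ℚ.≤ a ℚ.+ ε
unmove-ε {a} {ε} h = subst (ℚ._≤ a ℚ.+ ε) (ℚ.+-inverseˡ ε) (ℚ.+-monoˡ-≤ ε h)

-- Both sequences are eventually bounded by `B + C`, so an error `δ` in each factor costs at most
-- `(B + C) * δ`, which `share` makes equal to `ε`.
0≤* : ∀ {x y} → 0ᴿ ≤ᴿ x → 0ᴿ ≤ᴿ y → 0ᴿ ≤ᴿ x *ᴿ y
0≤* {x} {y} (mk≤ f) (mk≤ g) = mk≤ λ ε 0<ε →
  let (B , 0<B , M₁ , x≤B) = bounded (seq x) (cauchy x)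
      (C , 0<C , M₂ , y≤C) = bounded (seq y) (cauchy y)
      (δ , 0<δ , eq)       = share (ℚ.+-mono-< 0<B 0<C) 0<ε
      (M₃ , h)             = f δ 0<δ
      (M₄ , k)             = g δ 0<δ
      M₁₂ = M₁ ℕ.⊔ M₂
      M₃₄ = M₃ ℕ.⊔ M₄
      B≤ : B ℚ.≤ B ℚ.+ C
      B≤ = subst (ℚ._≤ B ℚ.+ C) (ℚ.+-identityʳ B) (ℚ.+-monoʳ-≤ B (ℚ.<⇒≤ 0<C))
      C≤ : C ℚ.≤ B ℚ.+ C
      C≤ = subst (ℚ._≤ B ℚ.+ C) (ℚ.+-identityˡ C) (ℚ.+-monoˡ-≤ C (ℚ.<⇒≤ 0<B))
  in M₁₂ ℕ.⊔ M₃₄ , λ n le → unmove-ε (subst (λ e → ℚ.- e ℚ.≤ seq x n ℚ.* seq y n) eq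
       (neg*-bound (ℚ.<⇒≤ 0<δ)
         (move-ε (h n (belowˡ M₃ M₄ (belowʳ M₁₂ M₃₄ le))))
         (move-ε (k n (belowʳ M₃ M₄ (belowʳ M₁₂ M₃₄ le))))
         (ℚ.≤-trans (x≤B n (belowˡ M₁ M₂ (belowˡ M₁₂ M₃₄ le))) B≤)
         (ℚ.≤-trans (y≤C n (belowʳ M₁ M₂ (belowˡ M₁₂ M₃₄ le))) C≤)))

*-monoʳ : ∀ {x y z} → 0ᴿ ≤ᴿ x → y ≤ᴿ z → x *ᴿ y ≤ᴿ x *ᴿ z
*-monoʳ {x} {y} {z} 0≤x y≤z = 0≤-⇒≤ (
  0ᴿ                      ≲⟨ 0≤* 0≤x (≤⇒0≤- y≤z) ⟩
  x *ᴿ (z -ᴿ y)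
    ≈⟨ ring (λ n → solve 3 (λ a b c → a :* (c :+ :- b) := a :* c :+ :- (a :* b)) refl (seq x n) (seq y n) (seq z n)) ⟩
  x *ᴿ z -ᴿ x *ᴿ y        ■)

*-monoˡ : ∀ {x y z} → 0ᴿ ≤ᴿ x → y ≤ᴿ z → y *ᴿ x ≤ᴿ z *ᴿ x
*-monoˡ {x} {y} {z} 0≤x y≤z = ≤-trans (proj₁ (*-comm y x)) (≤-trans (*-monoʳ 0≤x y≤z) (proj₁ (*-comm x z)))

*-congʳ : ∀ {x y z} → 0ᴿ ≤ᴿ x → y ≈ᴿ z → x *ᴿ y ≈ᴿ x *ᴿ z
*-congʳ 0≤x (h , k) = *-monoʳ 0≤x h , *-monoʳ 0≤x k

≤-ε : ∀ {x y} → (∀ ε → 0ℚ ℚ.< ε → x ≤ᴿ y +ᴿ fromℚ ε) → x ≤ᴿ y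
≤-ε {x} {y} h = mk≤ λ ε 0<ε →
  let (N , k) = ≤-eventually (h (ε ℚ.* ½) (half-pos 0<ε)) (ε ℚ.* ½) (half-pos 0<ε)
  in N , λ n le → ℚ.≤-trans (k n le) (ℚ.≤-reflexive
       (trans (ℚ.+-assoc (seq y n) (ε ℚ.* ½) (ε ℚ.* ½)) (cong (seq y n ℚ.+_) (halves ε))))

fromℚ-mono : ∀ {q r} → q ℚ.≤ r → fromℚ q ≤ᴿ fromℚ r
fromℚ-mono h = ≤-pointwise (λ _ → h)

0≤1 : 0ᴿ ≤ᴿ 1ᴿ
0≤1 = fromℚ-mono (ℚ.<⇒≤ (ℚ.positive⁻¹ 1ℚ))

<⇒≱ : ∀ {x y} → x <ᴿ y → ¬ (y ≤ᴿ x)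
<⇒≱ {x} {y} (mk< g 0<g (M , h)) (mk≤ f) =
  let (N , k) = f (g ℚ.* ½) (half-pos 0<g)
      n = M ℕ.⊔ N
      a = seq x n
      g/2 = g ℚ.* ½
      lt : a ℚ.+ g ℚ.≤ a ℚ.+ g/2
      lt = ℚ.≤-trans (h n (ℕ.m≤m⊔n M N)) (k n (ℕ.m≤n⊔m M N))
      lt′ : a ℚ.+ g/2 ℚ.< a ℚ.+ g
      lt′ = ℚ.+-monoʳ-< a (subst₂ ℚ._<_ (ℚ.+-identityʳ g/2) (halves g) (ℚ.+-monoʳ-< g/2 (half-pos 0<g)))
  in ℚ.<-irrefl refl (ℚ.≤-<-trans lt lt′)

gap≤ : ∀ {x y} (l : x <ᴿ y) → x +ᴿ fromℚ (gap l) ≤ᴿ y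
gap≤ {x} {y} (mk< g 0<g (M , h)) = mk≤ λ ε 0<ε → M , λ n le →
  ℚ.≤-trans (h n le) (subst (ℚ._≤ seq y n ℚ.+ ε) (ℚ.+-identityʳ (seq y n)) (ℚ.+-monoʳ-≤ (seq y n) (ℚ.<⇒≤ 0<ε)))

gap≤⇒< : ∀ {x y} q → 0ℚ ℚ.< q → x +ᴿ fromℚ q ≤ᴿ y → x <ᴿ y
gap≤⇒< {x} {y} q 0<q (mk≤ f) =
  -- Half of `q` absorbs the error that `≤ᴿ` allows; the other half remains as the gap.
  let (N , h) = f (q ℚ.* ½) (half-pos 0<q)
  in mk< (q ℚ.* ½) (half-pos 0<q) (N , λ n le → subst₂ ℚ._≤_
       (trans (cong (λ e → (seq x n ℚ.+ e) ℚ.- q ℚ.* ½) (sym (halves q)))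
         (solve 2 (λ a e → (a :+ (e :+ e)) :+ :- e := a :+ e) refl (seq x n) (q ℚ.* ½)))
       (solve 2 (λ a e → (a :+ e) :+ :- e := a) refl (seq y n) (q ℚ.* ½))
       (ℚ.+-monoˡ-≤ (ℚ.- (q ℚ.* ½)) (h n le)))

<⇒≤ : ∀ {x y} → x <ᴿ y → x ≤ᴿ y
<⇒≤ {x} {y} l =
  x                      ≈⟨ +-identityʳ x ⟨
  x +ᴿ 0ᴿ                ≲⟨ +-monoʳ x (fromℚ-mono (ℚ.<⇒≤ (gap>0 l))) ⟩
  x +ᴿ fromℚ (gap l)     ≲⟨ gap≤ l ⟩
  y                      ■

<-≤-trans : ∀ {x y z} → x <ᴿ y → y ≤ᴿ z → x <ᴿ z
<-≤-trans l h = gap≤⇒< (gap l) (gap>0 l) (≤-trans (gap≤ l) h)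

≤-<-trans : ∀ {x y z} → x ≤ᴿ y → y <ᴿ z → x <ᴿ z
≤-<-trans h l = gap≤⇒< (gap l) (gap>0 l) (≤-trans (+-monoˡ (fromℚ (gap l)) h) (gap≤ l))

rational-below : ∀ {x} → 0ᴿ <ᴿ x → ∃[ q ] 0ℚ ℚ.< q × fromℚ q ≤ᴿ x
rational-below {x} l = gap l , gap>0 l , ≤-trans (proj₂ (+-identityˡ _)) (gap≤ l)

fromℚ-pos : ∀ {q} → 0ℚ ℚ.< q → 0ᴿ <ᴿ fromℚ q
fromℚ-pos {q} 0<q = gap≤⇒< q 0<q (proj₁ (+-identityˡ _))

rational-above : ∀ x → ∃[ q ] x ≤ᴿ fromℚ q
rational-above x =
  let (B , 0<B , N , h) = bounded (seq x) (cauchy x)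
  in B , mk≤ λ ε 0<ε → N , λ n le → ℚ.≤-trans (p≤∣p∣ (seq x n)) (ℚ.≤-trans (h n le)
       (subst (ℚ._≤ B ℚ.+ ε) (ℚ.+-identityʳ B) (ℚ.+-monoʳ-≤ B (ℚ.<⇒≤ 0<ε))))

-- Finite sums

shift : ∀ {A : Set} → ℕ → (ℕ → A) → ℕ → A
shift m f i = f (m ℕ.+ i)

∑-mono : ∀ {a b} → (∀ n → a n ≤ᴿ b n) → ∀ N → ∑ a N ≤ᴿ ∑ b N
∑-mono h zero    = ≤-refl
∑-mono h (suc N) = +-mono (∑-mono h N) (h N)

0≤+ : ∀ {x y} → 0ᴿ ≤ᴿ x → 0ᴿ ≤ᴿ y → 0ᴿ ≤ᴿ x +ᴿ y
0≤+ h k = ≤-trans (proj₂ (+-identityˡ 0ᴿ)) (+-mono h k)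

x≤x+y : ∀ {x y} → 0ᴿ ≤ᴿ y → x ≤ᴿ x +ᴿ y
x≤x+y {x} h = ≤-trans (proj₂ (+-identityʳ x)) (+-monoʳ x h)

x≤y+x : ∀ {x y} → 0ᴿ ≤ᴿ y → x ≤ᴿ y +ᴿ x
x≤y+x {x} h = ≤-trans (proj₂ (+-identityˡ x)) (+-monoˡ x h)

∑-nonneg : ∀ {a} → (∀ n → 0ᴿ ≤ᴿ a n) → ∀ N → 0ᴿ ≤ᴿ ∑ a N
∑-nonneg h zero    = ≤-refl
∑-nonneg h (suc N) = 0≤+ (∑-nonneg h N) (h N)

∑-+ : ∀ a b N → ∑ (λ n → a n +ᴿ b n) N ≈ᴿ ∑ a N +ᴿ ∑ b N
∑-+ a b zero    = ≈-sym (+-identityˡ 0ᴿ)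
∑-+ a b (suc N) = ≈-trans (+-cong (∑-+ a b N) ≈-refl) (+-interchange (∑ a N) (∑ b N) (a N) (b N))

∑-* : ∀ x a N → ∑ (λ n → x *ᴿ a n) N ≈ᴿ x *ᴿ ∑ a N
∑-* x a zero    = ≈-sym (*-zeroʳ x)
∑-* x a (suc N) = ≈-trans (+-cong (∑-* x a N) ≈-refl) (≈-sym (*-distribˡ x (∑ a N) (a N)))

∑-split : ∀ a M N → ∑ a (M ℕ.+ N) ≈ᴿ ∑ a M +ᴿ ∑ (shift M a) N
∑-split a M zero rewrite ℕ.+-identityʳ M = ≈-sym (+-identityʳ (∑ a M))
∑-split a M (suc N) rewrite ℕ.+-suc M N =
  ≈-trans (+-cong (∑-split a M N) ≈-refl)
    (ring (λ n → ℚ.+-assoc (seq (∑ a M) n) (seq (∑ (shift M a) N) n) (seq (a (M ℕ.+ N)) n)))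

∑-head : ∀ a N → ∑ a (suc N) ≈ᴿ a 0 +ᴿ ∑ (a ∘ suc) N
∑-head a N = ≈-trans (∑-split a 1 N) (+-cong (+-identityˡ (a 0)) ≈-refl)

∑-monoʳ : ∀ {a M N} → (∀ n → 0ᴿ ≤ᴿ a n) → M ℕ.≤ N → ∑ a M ≤ᴿ ∑ a N
∑-monoʳ {a} {M} 0≤a M≤N with ℕ.m≤n⇒∃[o]m+o≡n M≤N
... | k , refl = ≤-trans (x≤x+y (∑-nonneg (λ n → 0≤a (M ℕ.+ n)) k)) (proj₂ (∑-split a M k))

term≤∑ : ∀ {a} → (∀ n → 0ᴿ ≤ᴿ a n) → ∀ N → a N ≤ᴿ ∑ a (suc N)
term≤∑ 0≤a N = x≤y+x (∑-nonneg 0≤a N)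

≤-from-∣-∣ : ∀ {p q δ} → ℚ.∣ p ℚ.- q ∣ ℚ.< δ → p ℚ.≤ q ℚ.+ δ
≤-from-∣-∣ {p} {q} {δ} h = begin
  p                    ≡⟨ solve 2 (λ p q → p := q :+ (p :+ :- q)) refl p q ⟩
  q ℚ.+ (p ℚ.- q)      ≤⟨ ℚ.+-monoʳ-≤ q (ℚ.≤-trans (p≤∣p∣ (p ℚ.- q)) (ℚ.<⇒≤ h)) ⟩
  q ℚ.+ δ              ∎
  where open ℚ.≤-Reasoning

∣-∣<-from : ∀ {p q δ} → p ℚ.< q ℚ.+ δ → q ℚ.< p ℚ.+ δ → ℚ.∣ p ℚ.- q ∣ ℚ.< δ
∣-∣<-from {p} {q} {δ} h k with ℚ.∣p∣≡p∨∣p∣≡-p (p ℚ.- q)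
... | inj₁ eq = subst₂ ℚ._<_ (sym eq) (solve 2 (λ q d → (q :+ d) :+ :- q := d) refl q δ) (ℚ.+-monoˡ-< (ℚ.- q) h)
... | inj₂ eq = subst₂ ℚ._<_ (trans (solve 2 (λ p q → q :+ :- p := :- (p :+ :- q)) refl p q) (sym eq))
  (solve 2 (λ q d → (q :+ d) :+ :- q := d) refl p δ) (ℚ.+-monoˡ-< (ℚ.- p) k)

-- Walking down from the failure at `K`, the first success met lies directly below a failure.
search : ∀ {P : ℕ → Set} → (∀ n → Dec (P n)) → P 0 → ∀ K → ¬ P K → ∃[ k ] P k × ¬ P (suc k)
search P? P0 zero ¬PK = ⊥-elim (¬PK P0)
search P? P0 (suc K) ¬PK with P? K
... | yes PK = K , PK , ¬PK
... | no ¬P  = search P? P0 K ¬P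

-- Classical comparison of reals and tails of series

module Classical (em : ExcludedMiddle 0ℓ) where

  ¬¬-elim : ∀ {A : Set} → ¬ ¬ A → A
  ¬¬-elim {A} ¬¬a with em {A}
  ... | yes a = a
  ... | no ¬a = contradiction ¬a ¬¬a

  ¬∀⇒∃¬ : ∀ {A : Set} {P : A → Set} → ¬ (∀ x → P x) → ∃[ x ] ¬ P x
  ¬∀⇒∃¬ ¬∀ = ¬¬-elim λ none → ¬∀ λ x → ¬¬-elim λ ¬Px → none (x , ¬Px)

  -- Some `ε` is exceeded by `x - y` at arbitrarily late indices. Beyond the index where both
  -- sequences vary by less than `ε / 4`, one such index leaves a difference of `ε / 2` at all
  -- others.
  ≰⇒> : ∀ {x y} → ¬ (x ≤ᴿ y) → y <ᴿ x
  ≰⇒> {x} {y} x≰y = result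
    where
    Eventually : ℚ → Set
    Eventually ε = ∃[ N ] ∀ n → N ℕ.≤ n → seq x n ℚ.≤ seq y n ℚ.+ ε
    bad : ∃[ ε ] ¬ (0ℚ ℚ.< ε → Eventually ε)
    bad = ¬∀⇒∃¬ (λ h → x≰y (mk≤ h))
    result : y <ᴿ x
    result with bad
    ... | ε , ¬h with em {0ℚ ℚ.< ε}
    ... | no ¬0<ε = ⊥-elim (¬h (⊥-elim ∘ ¬0<ε))
    ... | yes 0<ε =
      let δ = ε ℚ.* ½ ℚ.* ½
          0<δ = half-pos (half-pos 0<ε)
          (M , h) = cauchy x δ 0<δ
          (N , k) = cauchy y δ 0<δ
          L = M ℕ.⊔ N
          (n , ¬e) = ¬∀⇒∃¬ (λ e → ¬h (λ _ → L , e))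
          L≤n : L ℕ.≤ n
          L≤n = ¬¬-elim (λ ¬le → ¬e (⊥-elim ∘ ¬le))
          gt : seq y n ℚ.+ ε ℚ.≤ seq x n
          gt = ℚ.<⇒≤ (ℚ.≰⇒> (λ le → ¬e (λ _ → le)))
          open ℚ.≤-Reasoning
      in mk< (ε ℚ.* ½) (half-pos 0<ε) (L , λ m le → ℚ.≤-trans (begin
           seq y m ℚ.+ ε ℚ.* ½
             ≤⟨ ℚ.+-monoˡ-≤ (ε ℚ.* ½) {seq y m} (≤-from-∣-∣ {seq y m} {seq y n} (k m n (belowʳ M N le) (belowʳ M N L≤n))) ⟩
           (seq y n ℚ.+ δ) ℚ.+ ε ℚ.* ½
             ≡⟨ solve 3 (λ b d e → (b :+ d) :+ e := (b :+ (e :+ (d :+ d))) :+ :- d) refl (seq y n) δ (ε ℚ.* ½) ⟩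
           (seq y n ℚ.+ (ε ℚ.* ½ ℚ.+ (δ ℚ.+ δ))) ℚ.- δ
             ≡⟨ cong (λ e → (seq y n ℚ.+ e) ℚ.- δ) (trans (cong (ε ℚ.* ½ ℚ.+_) (halves (ε ℚ.* ½))) (halves ε)) ⟩
           (seq y n ℚ.+ ε) ℚ.- δ
             ≤⟨ ℚ.+-monoˡ-≤ (ℚ.- δ) gt ⟩
           seq x n ℚ.- δ
             ≤⟨ ℚ.+-monoˡ-≤ (ℚ.- δ) {seq x n} (≤-from-∣-∣ {seq x n} {seq x m} (h n m (belowˡ M N L≤n) (belowˡ M N le))) ⟩
           (seq x m ℚ.+ δ) ℚ.- δ
             ≡⟨ solve 2 (λ a d → (a :+ d) :+ :- d := a) refl (seq x m) δ ⟩
           seq x m ∎) ℚ.≤-refl)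

  ≮⇒≥ : ∀ {x y} → ¬ (x <ᴿ y) → y ≤ᴿ x
  ≮⇒≥ h = ¬¬-elim (h ∘ ≰⇒>)

  -- If `z < y`, the product of the gap with a positive rational below `x` separates `x * z` from
  -- `x * y`.
  *-cancelˡ : ∀ {x y z} → 0ᴿ <ᴿ x → x *ᴿ y ≤ᴿ x *ᴿ z → y ≤ᴿ z
  *-cancelˡ {x} {y} {z} 0<x h = ≮⇒≥ λ z<y →
    let (q , 0<q , q≤x) = rational-below 0<x
        g = gap z<y
    in <⇒≱ (gap≤⇒< {x *ᴿ z} {x *ᴿ y} (q ℚ.* g) (subst (ℚ._< q ℚ.* g) (ℚ.*-zeroʳ q) (ℚ.*-monoʳ-<-pos q {{ℚ.positive 0<q}} (gap>0 z<y))) (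
         x *ᴿ z +ᴿ fromℚ (q ℚ.* g)
           ≈⟨ +-cong (≈-refl {x *ᴿ z}) (ring {fromℚ (q ℚ.* g)} {fromℚ q *ᴿ fromℚ g} (λ _ → refl)) ⟩
         x *ᴿ z +ᴿ fromℚ q *ᴿ fromℚ g       ≲⟨ +-monoʳ (x *ᴿ z) (*-monoˡ (fromℚ-mono (ℚ.<⇒≤ (gap>0 z<y))) q≤x) ⟩
         x *ᴿ z +ᴿ x *ᴿ fromℚ g             ≈⟨ *-distribˡ x z (fromℚ g) ⟨
         x *ᴿ (z +ᴿ fromℚ g)                ≲⟨ *-monoʳ (<⇒≤ 0<x) (gap≤ z<y) ⟩
         x *ᴿ y                             ■)) h

  -- Otherwise a run of terms with sum above `ε` occurs beyond every index. Collecting `n` disjoint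
  -- runs makes a partial sum at least `n * ε`, which in the end exceeds `b`.
  ∑-tail : ∀ {a b} → (∀ n → 0ᴿ ≤ᴿ a n) → (∀ N → ∑ a N ≤ᴿ b) → ∀ ε → 0ℚ ℚ.< ε →
    ∃[ M ] ∀ N → M ℕ.≤ N → ∀ k → ∑ (shift N a) k ≤ᴿ fromℚ ε
  ∑-tail {a} {b} 0≤a a≤b ε 0<ε = ¬¬-elim λ none → absurd none
    where
    Tail : ℕ → Set
    Tail M = ∀ N → M ℕ.≤ N → ∀ k → ∑ (shift N a) k ≤ᴿ fromℚ ε
    grow : ¬ (∃[ M ] Tail M) → ∀ n → ∃[ N ] fromℚ (n ᵠ ℚ.* ε) ≤ᴿ ∑ a N
    grow none zero = 0 , fromℚ-mono (ℚ.≤-reflexive (ℚ.*-zeroˡ ε))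
    grow none (suc n) with grow none n
    ... | M , h with ¬∀⇒∃¬ (λ t → none (M , t))
    ... | N , k with ¬∀⇒∃¬ k
    ... | M≤N , l with ¬∀⇒∃¬ l
    ... | j , big = N ℕ.+ j , (
      fromℚ (suc n ᵠ ℚ.* ε)
        ≈⟨ ring (λ _ → trans (cong (ℚ._* ε) (suc-ᵠ n)) (solve 2 (λ n e → (n :+ con 1ℚ) :* e := n :* e :+ e) refl (n ᵠ) ε)) ⟩
      fromℚ (n ᵠ ℚ.* ε) +ᴿ fromℚ ε             ≲⟨ +-mono (≤-trans h (∑-monoʳ 0≤a M≤N)) (<⇒≤ (≰⇒> big)) ⟩
      ∑ a N +ᴿ ∑ (shift N a) j                 ≈⟨ ∑-split a N j ⟨
      ∑ a (N ℕ.+ j)                            ■)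
    absurd : ¬ ¬ (∃[ M ] Tail M)
    absurd none =
      let (B , b≤B) = rational-above b
          (n , B+1≤) = archimedean (B ℚ.+ 1ℚ) 0<ε
          (N , h) = grow none n
      in <⇒≱ (gap≤⇒< {fromℚ B} {fromℚ (B ℚ.+ 1ℚ)} 1ℚ (ℚ.positive⁻¹ 1ℚ) (≤-pointwise (λ _ → ℚ.≤-refl)))
           (≤-trans (fromℚ-mono B+1≤) (≤-trans h (≤-trans (a≤b N) b≤B)))

  -- Infima of nonempty sets of nonnegative reals

  module Infimum (S : Pred ℝ 0ℓ) (0≤S : ∀ c → S c → 0ᴿ ≤ᴿ c) {s₀ : ℝ} (s₀∈S : S s₀) where

    LowerBound : ℚ → Set
    LowerBound q = ∀ c → S c → fromℚ q ≤ᴿ c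

    -- Among the multiples of `ε`, 0 is a lower bound and those beyond `s₀` are not, so `search`
    -- finds a place where the property is lost.
    step : ∀ ε → 0ℚ ℚ.< ε → ∃[ q ] LowerBound q × ¬ LowerBound (q ℚ.+ ε)
    step ε 0<ε =
      let (B , s₀≤B)  = rational-above s₀
          (K , B+1≤K) = archimedean (B ℚ.+ 1ℚ) 0<ε
          (k , lb , ¬lb) = search (λ k → em {LowerBound (k ᵠ ℚ.* ε)})
             (λ c c∈S → ≤-trans (fromℚ-mono (ℚ.≤-reflexive (ℚ.*-zeroˡ ε))) (0≤S c c∈S)) K
             (λ h → <⇒≱ (gap≤⇒< {fromℚ B} {fromℚ (B ℚ.+ 1ℚ)} 1ℚ (ℚ.positive⁻¹ 1ℚ) (≤-pointwise (λ _ → ℚ.≤-refl)))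
                      (≤-trans (fromℚ-mono B+1≤K) (≤-trans (h s₀ s₀∈S) s₀≤B)))
      in k ᵠ ℚ.* ε , lb , λ h → ¬lb (subst LowerBound
           (sym (trans (cong (ℚ._* ε) (suc-ᵠ k)) (solve 2 (λ n e → (n :+ con 1ℚ) :* e := n :* e :+ e) refl (k ᵠ) ε))) h)

    1/suc : ℕ → ℚ
    1/suc n = ℚ.1/ (suc n ᵠ)

    1/suc-pos : ∀ n → 0ℚ ℚ.< 1/suc n
    1/suc-pos n = ℚ.positive⁻¹ (1/suc n) {{ℚ.1/pos⇒pos (suc n ᵠ)}}

    1/suc-small : ∀ ε → 0ℚ ℚ.< ε → ∃[ N ] ∀ n → N ℕ.≤ n → 1/suc n ℚ.< ε
    1/suc-small ε 0<ε = let (K , 1≤Kε) = 1≤-ᵠ* 0<ε in K , λ n K≤n →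
      ℚ.*-cancelˡ-<-nonNeg (suc n ᵠ) (let open ℚ.≤-Reasoning in begin-strict
        suc n ᵠ ℚ.* 1/suc n     ≡⟨ ℚ.*-inverseʳ (suc n ᵠ) ⟩
        1ℚ                      ≤⟨ 1≤Kε ⟩
        K ᵠ ℚ.* ε
          <⟨ ℚ.*-monoˡ-<-pos ε {{ℚ.positive 0<ε}} {K ᵠ} {suc n ᵠ} (ℚ.*<* (ℤ.*-monoʳ-<-pos (+ 1) (ℤ.+<+ (ℕ.s≤s K≤n)))) ⟩
        suc n ᵠ ℚ.* ε           ∎)

    q : ℕ → ℚ
    q n = proj₁ (step (1/suc n) (1/suc-pos n))

    q-lower : ∀ n → LowerBound (q n)
    q-lower n = proj₁ (proj₂ (step (1/suc n) (1/suc-pos n)))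

    q-upper : ∀ n → ¬ LowerBound (q n ℚ.+ 1/suc n)
    q-upper n = proj₂ (proj₂ (step (1/suc n) (1/suc-pos n)))

    -- A lower bound stays below every rational that fails to be one, and `q n + 1/suc n` fails.
    -- This makes `q` a Cauchy sequence.
    q-near : ∀ m n {ε} → 1/suc n ℚ.< ε → q m ℚ.< q n ℚ.+ ε
    q-near m n small = ℚ.<-trans (ℚ.≰⇒> λ le → q-upper n (λ c c∈S → ≤-trans (fromℚ-mono le) (q-lower m c c∈S)))
                                 (ℚ.+-monoʳ-< (q n) small)

    inf : ℝ
    seq    inf = q
    cauchy inf ε 0<ε = let (N , small) = 1/suc-small ε 0<ε in N , λ m n N≤m N≤n →
      ∣-∣<-from (q-near m n (small n N≤n)) (q-near n m (small m N≤m))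

    inf-isInfimum : IsInfimum S inf
    inf-isInfimum = lower , greatest
      where
      lower : ∀ c → S c → inf ≤ᴿ c
      lower c c∈S = ≤-ε λ ε 0<ε →
        let (N , small) = 1/suc-small ε 0<ε in
        inf
          ≲⟨ mk≤ (λ δ 0<δ → 0 , λ n _ → ℚ.≤-trans (ℚ.<⇒≤ (q-near n N (small N ℕ.≤-refl)))
                                           (subst (ℚ._≤ q N ℚ.+ ε ℚ.+ δ) (ℚ.+-identityʳ _) (ℚ.+-monoʳ-≤ (q N ℚ.+ ε) (ℚ.<⇒≤ 0<δ)))) ⟩
        fromℚ (q N) +ᴿ fromℚ ε        ≲⟨ +-monoˡ (fromℚ ε) (q-lower N c c∈S) ⟩
        c +ᴿ fromℚ ε                  ■
      greatest : ∀ l → (∀ c → S c → l ≤ᴿ c) → l ≤ᴿ inf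
      greatest l l≤S = ≤-ε λ ε 0<ε →
        let δ           = ε ℚ.* ½
            (N , small) = 1/suc-small δ (half-pos 0<ε)
            -- As `q N + 1/suc N` is not a lower bound, some element `c` of `S` lies below it.
            (c , ¬h)    = ¬∀⇒∃¬ (q-upper N)
            (c∈S , ¬le) = ¬∀⇒∃¬ ¬h
        in
        l                                     ≲⟨ l≤S c c∈S ⟩
        c                                     ≲⟨ <⇒≤ (≰⇒> ¬le) ⟩
        fromℚ (q N ℚ.+ 1/suc N)               ≲⟨ fromℚ-mono (ℚ.+-monoʳ-≤ (q N) (ℚ.<⇒≤ (small N ℕ.≤-refl))) ⟩
        fromℚ (q N ℚ.+ δ)                     ≲⟨ ≤-pointwise (λ _ → ℚ.≤-refl) ⟩
        fromℚ (q N) +ᴿ fromℚ δ                ≲⟨ +-monoˡ (fromℚ δ) (mk≤ (λ η 0<η → N , λ n N≤n →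
                                                  ℚ.≤-trans (ℚ.<⇒≤ (q-near N n (small n N≤n)))
                                                    (subst (ℚ._≤ q n ℚ.+ δ ℚ.+ η) (ℚ.+-identityʳ _) (ℚ.+-monoʳ-≤ (q n ℚ.+ δ) (ℚ.<⇒≤ 0<η))))) ⟩
        (inf +ᴿ fromℚ δ) +ᴿ fromℚ δ
          ≈⟨ ring (λ n → trans (ℚ.+-assoc (q n) δ δ) (cong (q n ℚ.+_) (halves ε))) ⟩
        inf +ᴿ fromℚ ε                        ■

-- Weights

Bias : (ℕ → ℝ) → Set
Bias p = ∀ n → 0ᴿ <ᴿ p n × p n ≤ᴿ ½ᴿ

½≤1- : ∀ {x} → x ≤ᴿ ½ᴿ → ½ᴿ ≤ᴿ 1ᴿ -ᴿ x
½≤1- {x} h = 0≤-⇒≤ (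
  0ᴿ                    ≲⟨ ≤⇒0≤- h ⟩
  ½ᴿ -ᴿ x
    ≈⟨ ring (λ n → solve 1 (λ a → con ½ :+ :- a := (con 1ℚ :+ :- a) :+ :- con ½) refl (seq x n)) ⟩
  (1ᴿ -ᴿ x) -ᴿ ½ᴿ       ■)

0<½ : 0ᴿ <ᴿ ½ᴿ
0<½ = fromℚ-pos (ℚ.positive⁻¹ ½)

module _ {p : ℕ → ℝ} (bias : Bias p) where

  0<p : ∀ n → 0ᴿ <ᴿ p n
  0<p n = proj₁ (bias n)

  0<1-p : ∀ n → 0ᴿ <ᴿ 1ᴿ -ᴿ p n
  0<1-p n = <-≤-trans 0<½ (½≤1- (proj₂ (bias n)))

  0≤p : ∀ n → 0ᴿ ≤ᴿ p n
  0≤p n = <⇒≤ (0<p n)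

  0≤1-p : ∀ n → 0ᴿ ≤ᴿ 1ᴿ -ᴿ p n
  0≤1-p n = <⇒≤ (0<1-p n)

0<* : ∀ {x y} → 0ᴿ <ᴿ x → 0ᴿ <ᴿ y → 0ᴿ <ᴿ x *ᴿ y
0<* {x} {y} 0<x 0<y =
  let (q , 0<q , q≤x) = rational-below 0<x
      (r , 0<r , r≤y) = rational-below 0<y
  in <-≤-trans (fromℚ-pos (subst (ℚ._< q ℚ.* r) (ℚ.*-zeroʳ q) (ℚ.*-monoʳ-<-pos q {{ℚ.positive 0<q}} 0<r))) (
     fromℚ (q ℚ.* r)         ≈⟨ ring (λ _ → refl) ⟩
     fromℚ q *ᴿ fromℚ r      ≲⟨ *-monoʳ (fromℚ-mono (ℚ.<⇒≤ 0<q)) r≤y ⟩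
     fromℚ q *ᴿ y            ≲⟨ *-monoˡ (<⇒≤ 0<y) q≤x ⟩
     x *ᴿ y                  ■)

0<stringWeight : ∀ {p} → Bias p → ∀ s → 0ᴿ <ᴿ stringWeight p s
0<stringWeight bias []          = fromℚ-pos (ℚ.positive⁻¹ 1ℚ)
0<stringWeight bias (true ∷ s)  = 0<* (0<p bias 0) (0<stringWeight (bias ∘ suc) s)
0<stringWeight bias (false ∷ s) = 0<* (0<1-p bias 0) (0<stringWeight (bias ∘ suc) s)

0≤stringWeight : ∀ {p} → Bias p → ∀ s → 0ᴿ ≤ᴿ stringWeight p s
0≤stringWeight bias s = <⇒≤ (0<stringWeight bias s)

0≤weight : ∀ {p} → Bias p → ∀ C → 0ᴿ ≤ᴿ weight p C
0≤weight bias nothing  = ≤-refl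
0≤weight bias (just s) = 0≤stringWeight bias s

listWeight : (ℕ → ℝ) → List (List Bool) → ℝ
listWeight p []      = 0ᴿ
listWeight p (s ∷ l) = stringWeight p s +ᴿ listWeight p l

0≤listWeight : ∀ {p} → Bias p → ∀ l → 0ᴿ ≤ᴿ listWeight p l
0≤listWeight bias []      = ≤-refl
0≤listWeight bias (s ∷ l) = 0≤+ (0≤stringWeight bias s) (0≤listWeight bias l)

+-assocᴿ : ∀ x y z → (x +ᴿ y) +ᴿ z ≈ᴿ x +ᴿ (y +ᴿ z)
+-assocᴿ x y z = ring (λ n → ℚ.+-assoc (seq x n) (seq y n) (seq z n))

listWeight-++ : ∀ p l m → listWeight p (l ++ m) ≈ᴿ listWeight p l +ᴿ listWeight p m
listWeight-++ p []      m = ≈-sym (+-identityˡ _)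
listWeight-++ p (s ∷ l) m = ≈-trans (+-cong ≈-refl (listWeight-++ p l m)) (≈-sym (+-assocᴿ _ _ _))

listWeight-fromMaybe : ∀ p C → listWeight p (fromMaybe C) ≈ᴿ weight p C
listWeight-fromMaybe p nothing  = ≈-refl
listWeight-fromMaybe p (just s) = +-identityʳ _

-- Covers

infix 4 _∈⋃_
_∈⋃_ : 2^ω → List (List Bool) → Set
x ∈⋃ l = Any (λ s → ⟦ just s ⟧ x) l

-- Passing to the next list emits one `nothing`, which keeps the recursion on the index structural
-- even if many lists are empty and adds no weight.
flatten : List (List Bool) → (ℕ → List (List Bool)) → ℕ → Cyl
flatten []      L zero    = nothing
flatten []      L (suc k) = flatten (L 0) (L ∘ suc) k
flatten (s ∷ l) L zero    = just s
flatten (s ∷ l) L (suc k) = flatten l L k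

flatten-first : ∀ {x} l L → x ∈⋃ l → ∃[ k ] ⟦ flatten l L k ⟧ x
flatten-first (s ∷ l) L (here h)  = 0 , h
flatten-first (s ∷ l) L (there h) = let (k , e) = flatten-first l L h in suc k , e

flatten-covers : ∀ {x} l L i → x ∈⋃ L i → ∃[ k ] ⟦ flatten l L k ⟧ x
flatten-covers (s ∷ l) L i       h = let (k , e) = flatten-covers l L i h in suc k , e
flatten-covers []      L zero    h = let (k , e) = flatten-first (L 0) (L ∘ suc) h in suc k , e
flatten-covers []      L (suc i) h = let (k , e) = flatten-covers (L 0) (L ∘ suc) i h in suc k , e

∑-flatten : ∀ {p} → Bias p → ∀ l L N →
  ∑ (weight p ∘ flatten l L) N ≤ᴿ listWeight p l +ᴿ ∑ (listWeight p ∘ L) N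
∑-flatten bias l L zero = x≤y+x (0≤listWeight bias l)
∑-flatten {p} bias [] L (suc N) =
  ∑ (weight p ∘ flatten [] L) (suc N)                                   ≈⟨ ∑-head _ N ⟩
  0ᴿ +ᴿ ∑ (weight p ∘ flatten (L 0) (L ∘ suc)) N
    ≲⟨ +-monoʳ 0ᴿ (∑-flatten bias (L 0) (L ∘ suc) N) ⟩
  0ᴿ +ᴿ (listWeight p (L 0) +ᴿ ∑ (listWeight p ∘ L ∘ suc) N)
    ≈⟨ +-cong ≈-refl (∑-head (listWeight p ∘ L) N) ⟨
  0ᴿ +ᴿ ∑ (listWeight p ∘ L) (suc N)                                    ■
∑-flatten {p} bias (s ∷ l) L (suc N) =
  ∑ (weight p ∘ flatten (s ∷ l) L) (suc N)                              ≈⟨ ∑-head _ N ⟩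
  stringWeight p s +ᴿ ∑ (weight p ∘ flatten l L) N                      ≲⟨ +-monoʳ _ (∑-flatten bias l L N) ⟩
  stringWeight p s +ᴿ (listWeight p l +ᴿ ∑ (listWeight p ∘ L) N)        ≈⟨ +-assocᴿ _ _ _ ⟨
  listWeight p (s ∷ l) +ᴿ ∑ (listWeight p ∘ L) N
    ≲⟨ +-monoʳ _ (x≤x+y (0≤listWeight bias (L N))) ⟩
  listWeight p (s ∷ l) +ᴿ ∑ (listWeight p ∘ L) (suc N)                  ■

cover-by-lists : ∀ {p E c} → Bias p → (L : ℕ → List (List Bool)) → (∀ x → E x → ∃[ i ] x ∈⋃ L i) →
  (∀ N → ∑ (listWeight p ∘ L) N ≤ᴿ c) → CoverBound p E c
cover-by-lists bias L covers L≤c = flatten [] L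
  , (λ x x∈E → let (i , h) = covers x x∈E in flatten-covers [] L i h)
  , λ N → ≤-trans (∑-flatten bias [] L N) (≤-trans (proj₁ (+-identityˡ _)) (L≤c N))

-- Lists the antidiagonal `i + j = D` of a double sequence, which makes a countable union of covers
-- into one sequence of finite lists.
diagonal : (ℕ → ℕ → Cyl) → ℕ → List (List Bool)
diagonal C zero    = fromMaybe (C 0 0)
diagonal C (suc D) = fromMaybe (C 0 (suc D)) ++ diagonal (C ∘ suc) D

∈-fromMaybe : ∀ {x} C → ⟦ C ⟧ x → x ∈⋃ fromMaybe C
∈-fromMaybe (just s) h = here h

∈-diagonal : ∀ {x} C i j → ⟦ C i j ⟧ x → x ∈⋃ diagonal C (i ℕ.+ j)
∈-diagonal C zero    zero    h = ∈-fromMaybe (C 0 0) h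
∈-diagonal C zero    (suc j) h = Any.++⁺ˡ (∈-fromMaybe (C 0 (suc j)) h)
∈-diagonal C (suc i) j       h = Any.++⁺ʳ (fromMaybe (C 0 (suc (i ℕ.+ j)))) (∈-diagonal (C ∘ suc) i j h)

∑-cong : ∀ {a b} → (∀ n → a n ≈ᴿ b n) → ∀ N → ∑ a N ≈ᴿ ∑ b N
∑-cong h N = ∑-mono (proj₁ ∘ h) N , ∑-mono (proj₂ ∘ h) N

-- The first `N` diagonals form a triangle. Removing the row `C 0` leaves the triangle of the other
-- rows, so each row is charged once.
∑-diagonal : ∀ {p c} → ∀ C → (∀ i N → ∑ (weight p ∘ C i) N ≤ᴿ c i) →
  ∀ N → ∑ (listWeight p ∘ diagonal C) N ≤ᴿ ∑ c N
∑-diagonal C h zero = ≤-refl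
∑-diagonal {p} {c} C h (suc N) =
  ∑ (listWeight p ∘ diagonal C) (suc N)
    ≈⟨ ∑-head _ N ⟩
  listWeight p (fromMaybe (C 0 0)) +ᴿ ∑ (listWeight p ∘ diagonal C ∘ suc) N
    ≈⟨ +-cong (listWeight-fromMaybe p (C 0 0)) (≈-trans
         (∑-cong (λ D → ≈-trans (listWeight-++ p (fromMaybe (C 0 (suc D))) (diagonal (C ∘ suc) D))
                                (+-cong (listWeight-fromMaybe p (C 0 (suc D))) ≈-refl)) N)
         (∑-+ (weight p ∘ C 0 ∘ suc) (listWeight p ∘ diagonal (C ∘ suc)) N)) ⟩
  weight p (C 0 0) +ᴿ (∑ (weight p ∘ C 0 ∘ suc) N +ᴿ ∑ (listWeight p ∘ diagonal (C ∘ suc)) N)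
    ≈⟨ +-assocᴿ _ _ _ ⟨
  (weight p (C 0 0) +ᴿ ∑ (weight p ∘ C 0 ∘ suc) N) +ᴿ ∑ (listWeight p ∘ diagonal (C ∘ suc)) N
    ≈⟨ +-cong (∑-head (weight p ∘ C 0) N) ≈-refl ⟨
  ∑ (weight p ∘ C 0) (suc N) +ᴿ ∑ (listWeight p ∘ diagonal (C ∘ suc)) N
    ≲⟨ +-mono (h 0 (suc N)) (∑-diagonal (C ∘ suc) (h ∘ suc) N) ⟩
  c 0 +ᴿ ∑ (c ∘ suc) N
    ≈⟨ ∑-head c N ⟨
  ∑ c (suc N) ■

-- Countable subadditivity of the outer measure, at the level of covers.
cover-⋃ : ∀ {p} → Bias p → {E : ℕ → Pred 2^ω 0ℓ} {c : ℕ → ℝ} {b : ℝ} →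
  (∀ i → CoverBound p (E i) (c i)) → (∀ N → ∑ c N ≤ᴿ b) →
  CoverBound p (λ x → ∃[ i ] E i x) b
cover-⋃ bias covers c≤b = cover-by-lists bias (diagonal C)
  (λ x (i , x∈E) → let (j , h) = proj₁ (proj₂ (covers i)) x x∈E in i ℕ.+ j , ∈-diagonal C i j h)
  (λ N → ≤-trans (∑-diagonal C (λ i → proj₂ (proj₂ (covers i))) N) (c≤b N))
  where
  C : ℕ → ℕ → Cyl
  C i = proj₁ (covers i)

cover-mono : ∀ {p} {E E′ : Pred 2^ω 0ℓ} {c c′} → (∀ x → E x → E′ x) → c ≤ᴿ c′ →
  CoverBound p E′ c → CoverBound p E c′
cover-mono E⊆E′ c≤c′ (C , covers , C≤c) = C , (λ x → covers x ∘ E⊆E′ x) , λ N → ≤-trans (C≤c N) c≤c′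

cover-∅ : ∀ {p} → CoverBound p (λ _ → ⊥) 0ᴿ
cover-∅ {p} = (λ _ → nothing) , (λ _ ()) , ∑0
  where
  ∑0 : ∀ N → ∑ (weight p ∘ (λ _ → nothing)) N ≤ᴿ 0ᴿ
  ∑0 zero    = ≤-refl
  ∑0 (suc N) = ≤-trans (proj₁ (+-identityʳ _)) (∑0 N)

cover-list : ∀ {p} → Bias p → ∀ l → CoverBound p (_∈⋃ l) (listWeight p l)
cover-list {p} bias l = cover-by-lists bias L (λ x h → 0 , h) bound
  where
  L : ℕ → List (List Bool)
  L zero    = l
  L (suc _) = []
  bound : ∀ N → ∑ (listWeight p ∘ L) N ≤ᴿ listWeight p l
  bound zero          = 0≤listWeight bias l
  bound (suc zero)    = proj₁ (+-identityˡ _)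
  bound (suc (suc N)) = ≤-trans (proj₁ (+-identityʳ _)) (bound (suc N))

cover-cylinder : ∀ {p} → Bias p → ∀ s → CoverBound p ⟦ just s ⟧ (stringWeight p s)
cover-cylinder bias s = cover-mono (λ x h → here h) (proj₁ (+-identityʳ _)) (cover-list bias (s ∷ []))

cover-∪ : ∀ {p} → Bias p → ∀ {E E′ : Pred 2^ω 0ℓ} {c c′} →
  CoverBound p E c → CoverBound p E′ c′ → CoverBound p (λ x → E x ⊎ E′ x) (c +ᴿ c′)
cover-∪ {p} bias {E} {E′} {c} {c′} cover cover′ = cover-mono
  (λ { x (inj₁ h) → 0 , h ; x (inj₂ h) → 1 , h }) ≤-refl
  (cover-⋃ bias {Es} {cs} covers bound)
  where
  Es : ℕ → Pred 2^ω 0ℓ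
  Es 0 = E
  Es 1 = E′
  Es (suc (suc _)) _ = ⊥
  cs : ℕ → ℝ
  cs 0 = c
  cs 1 = c′
  cs (suc (suc _)) = 0ᴿ
  covers : ∀ i → CoverBound p (Es i) (cs i)
  covers 0 = cover
  covers 1 = cover′
  covers (suc (suc _)) = cover-∅
  0≤c : 0ᴿ ≤ᴿ c
  0≤c = proj₂ (proj₂ cover) 0
  0≤c′ : 0ᴿ ≤ᴿ c′
  0≤c′ = proj₂ (proj₂ cover′) 0
  bound : ∀ N → ∑ cs N ≤ᴿ c +ᴿ c′
  bound 0 = 0≤+ 0≤c 0≤c′
  bound 1 = ≤-trans (proj₁ (+-identityˡ _)) (x≤x+y 0≤c′)
  bound 2 = +-monoˡ c′ (proj₁ (+-identityˡ _))
  bound (suc (suc (suc N))) = ≤-trans (proj₁ (+-identityʳ _)) (bound (suc (suc N)))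

-- Null sets

-- Outer measure zero, expressed through covers so that no infimum has to be constructed.
Null : (ℕ → ℝ) → Pred 2^ω 0ℓ → Set
Null p E = ∀ ε → 0ℚ ℚ.< ε → CoverBound p E (fromℚ ε)

geometric : ℚ → ℕ → ℚ
geometric ε zero    = ε
geometric ε (suc n) = geometric ε n ℚ.* ½

geometric-pos : ∀ {ε} → 0ℚ ℚ.< ε → ∀ n → 0ℚ ℚ.< geometric ε n
geometric-pos 0<ε zero    = 0<ε
geometric-pos 0<ε (suc n) = half-pos (geometric-pos 0<ε n)

-- The partial sum and the remainder `geometric ε N` always add up to exactly `ε`.
∑-geometric : ∀ {ε} → 0ℚ ℚ.< ε → ∀ N → ∑ (λ n → fromℚ (geometric ε (suc n))) N ≤ᴿ fromℚ ε
∑-geometric {ε} 0<ε N = ≤-trans (x≤x+y (fromℚ-mono (ℚ.<⇒≤ (geometric-pos 0<ε N)))) (proj₁ (exact N))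
  where
  exact : ∀ N → ∑ (λ n → fromℚ (geometric ε (suc n))) N +ᴿ fromℚ (geometric ε N) ≈ᴿ fromℚ ε
  exact zero    = +-identityˡ _
  exact (suc N) = ≈-trans (ring (λ n → trans (ℚ.+-assoc (seq (∑ _ N) n) (geometric ε N ℚ.* ½) (geometric ε N ℚ.* ½)) (cong (seq (∑ _ N) n ℚ.+_) (halves (geometric ε N))))) (exact N)

-- Outer measure, measurability of null sets and the Borel-Cantelli lemma

module Measure (em : ExcludedMiddle 0ℓ) {p : ℕ → ℝ} (bias : Bias p) where
  open Classical em

  outer-measure : ∀ E → ∃[ r ] μ[ p ] E ≈ r
  outer-measure E = Infimum.inf (CoverBound p E) (λ c h → proj₂ (proj₂ h) 0) cover-1
                  , Infimum.inf-isInfimum (CoverBound p E) (λ c h → proj₂ (proj₂ h) 0) cover-1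
    where
    -- The cylinder of the empty string is the whole space.
    cover-1 : CoverBound p E 1ᴿ
    cover-1 = cover-mono (λ _ _ → refl) ≤-refl (cover-cylinder bias [])

  -- The infimum `r` need not be attained, but `x` is not a lower bound, so a cover cheaper than `x`
  -- exists.
  μ-cover : ∀ {E r x} → μ[ p ] E ≈ r → r <ᴿ x → CoverBound p E x
  μ-cover {E} {r} {x} (_ , greatest) r<x =
    let (c , ¬h)    = ¬∀⇒∃¬ (λ h → <⇒≱ r<x (greatest x h))
        (cover , ¬le) = ¬∀⇒∃¬ ¬h
    in cover-mono (λ _ h → h) (<⇒≤ (≰⇒> ¬le)) cover

  0≤μ : ∀ {E r} → μ[ p ] E ≈ r → 0ᴿ ≤ᴿ r
  0≤μ (_ , greatest) = greatest 0ᴿ (λ c h → proj₂ (proj₂ h) 0)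

  -- The part of `T` inside `E` has value 0, and adding an arbitrarily cheap cover of `E` turns a
  -- cover of the part outside `E` into a cover of `T`.
  null⇒measurable : ∀ {E} → Null p E → Measurable p E
  null⇒measurable {E} null T r s t μT μTE μT∁E = r≤s+t , s+t≤r
    where
    r≤s+t : r ≤ᴿ s +ᴿ t
    r≤s+t = ≤-trans (proj₂ μT∁E r λ c cover → ≤-ε λ ε 0<ε →
        proj₁ μT (c +ᴿ fromℚ ε) (cover-mono
          (λ x x∈T → [ inj₂ , (λ x∉E → inj₁ (x∈T , x∉E)) ]′ (dec x)) ≤-refl
          (cover-∪ bias cover (null ε 0<ε))))
      (x≤y+x (0≤μ μTE))
      where
      dec : ∀ x → E x ⊎ ¬ E x
      dec x with em {E x}
      ... | yes h = inj₁ h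
      ... | no h  = inj₂ h
    s+t≤r : s +ᴿ t ≤ᴿ r
    s+t≤r =
      s +ᴿ t     ≲⟨ +-mono {s} {0ᴿ} {t} {r}
                     (≤-ε λ ε 0<ε → ≤-trans (proj₁ μTE (fromℚ ε) (cover-mono (λ _ → proj₂) ≤-refl (null ε 0<ε))) (proj₂ (+-identityˡ _)))
                     (proj₂ μT t (λ c cover → proj₁ μT∁E c (cover-mono (λ _ → proj₁) ≤-refl cover))) ⟩
      0ᴿ +ᴿ r    ≈⟨ +-identityˡ r ⟩
      r          ■

  -- Every late tail of the events `Meets (𝒜 n)` covers `F`. One half of `ε` pays for the tail, the
  -- other for the surplus `η` by which actual covers exceed the infima.
  borel-cantelli : ∀ {F 𝒜} → IsWitness p F 𝒜 → Null p F
  borel-cantelli {F} {𝒜} witness ε 0<ε =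
    let (a , μ𝒜 , b , a≤b) = IsWitness.summable witness
        δ = ε ℚ.* ½
        0<δ = half-pos 0<ε
        (M , tail) = ∑-tail (λ n → 0≤μ (μ𝒜 (suc n))) a≤b δ 0<δ
        η = λ n → fromℚ (geometric δ (suc n))
    in cover-mono
      -- The sum starts at index 1, so the tail after `M` terms consists of the indices from `suc M`
      -- on.
      (λ X X∈F → let (n , M<n , meets) = IsWitness.hits witness X X∈F (suc M)
                     (i , eq) = ℕ.m≤n⇒∃[o]m+o≡n M<n
                 in i , subst (λ n → Meets (𝒜 n) X) (sym eq) meets)
      ≤-refl
      (cover-⋃ bias {λ i → Meets (𝒜 (suc (M ℕ.+ i)))} {λ i → a (suc (M ℕ.+ i)) +ᴿ η i}
        (λ i → μ-cover (μ𝒜 (suc (M ℕ.+ i)))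
          (gap≤⇒< (geometric δ (suc i)) (geometric-pos 0<δ (suc i)) ≤-refl))
        (λ N →
          ∑ (λ i → a (suc (M ℕ.+ i)) +ᴿ η i) N       ≈⟨ ∑-+ (shift M (a ∘ suc)) η N ⟩
          ∑ (shift M (a ∘ suc)) N +ᴿ ∑ η N           ≲⟨ +-mono (tail M ℕ.≤-refl N) (∑-geometric 0<δ N) ⟩
          fromℚ δ +ᴿ fromℚ δ                         ≈⟨ ring (λ _ → halves ε) ⟩
          fromℚ ε                                    ■))

-- Derivatives of cylinders

-- The section of a cylinder at the first digit `b`, that is, the set of continuations that remain
-- inside it; the whole space is its own section.
∂ : Bool → Cyl → Cyl
∂ b     nothing            = nothing
∂ b     (just [])          = just []
∂ true  (just (true ∷ s))  = just s
∂ true  (just (false ∷ s)) = nothing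
∂ false (just (true ∷ s))  = nothing
∂ false (just (false ∷ s)) = just s

weight-∂ : ∀ p C → weight p C ≈ᴿ p 0 *ᴿ weight (p ∘ suc) (∂ true C) +ᴿ (1ᴿ -ᴿ p 0) *ᴿ weight (p ∘ suc) (∂ false C)
weight-∂ p nothing = ring (λ n → solve 1 (λ a → con 0ℚ := a :* con 0ℚ :+ (con 1ℚ :+ :- a) :* con 0ℚ) refl (seq (p 0) n))
weight-∂ p (just []) = ring (λ n → solve 1 (λ a → con 1ℚ := a :* con 1ℚ :+ (con 1ℚ :+ :- a) :* con 1ℚ) refl (seq (p 0) n))
weight-∂ p (just (true ∷ s)) = ring (λ n → solve 2 (λ a w → a :* w := a :* w :+ (con 1ℚ :+ :- a) :* con 0ℚ) refl (seq (p 0) n) (seq (stringWeight (p ∘ suc) s) n))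
weight-∂ p (just (false ∷ s)) = ring (λ n → solve 2 (λ a w → (con 1ℚ :+ :- a) :* w := a :* con 0ℚ :+ (con 1ℚ :+ :- a) :* w) refl (seq (p 0) n) (seq (stringWeight (p ∘ suc) s) n))

∈-∂ : ∀ {x b} C → x 0 ≡ b → ⟦ C ⟧ x → ⟦ ∂ b C ⟧ (x ∘ suc)
∈-∂ (just [])                  eq h = refl
∈-∂ {b = true}  (just (true ∷ s))  eq h = List.∷-injectiveʳ h
∈-∂ {b = false} (just (false ∷ s)) eq h = List.∷-injectiveʳ h
∈-∂ {b = true}  (just (false ∷ s)) eq h with trans (sym eq) (List.∷-injectiveˡ h)
... | ()
∈-∂ {b = false} (just (true ∷ s))  eq h with trans (sym eq) (List.∷-injectiveˡ h)
... | ()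

∂* : List Bool → Cyl → Cyl
∂* []      C = C
∂* (b ∷ u) C = ∂* u (∂ b C)

-- The left side is the measure of the part of `C` inside the cylinder of `u`: each digit keeps one
-- of the two summands of `weight-∂` and drops a nonnegative one.
weight-∂* : ∀ {p} → Bias p → ∀ u C → stringWeight p u *ᴿ weight (shift (length u) p) (∂* u C) ≤ᴿ weight p C
weight-∂* bias [] C = proj₁ (*-identityˡ _)
weight-∂* {p} bias (true ∷ u) C =
  (p 0 *ᴿ stringWeight (p ∘ suc) u) *ᴿ weight (shift (length u) (p ∘ suc)) (∂* u (∂ true C))  ≈⟨ *-assoc _ _ _ ⟩
  p 0 *ᴿ (stringWeight (p ∘ suc) u *ᴿ weight (shift (length u) (p ∘ suc)) (∂* u (∂ true C)))
    ≲⟨ *-monoʳ (0≤p bias 0) (weight-∂* (bias ∘ suc) u (∂ true C)) ⟩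
  p 0 *ᴿ weight (p ∘ suc) (∂ true C)
    ≲⟨ x≤x+y (0≤* (0≤1-p bias 0) (0≤weight (bias ∘ suc) (∂ false C))) ⟩
  _                                                                                          ≈⟨ weight-∂ p C ⟨
  weight p C                                                                                 ■
weight-∂* {p} bias (false ∷ u) C =
  ((1ᴿ -ᴿ p 0) *ᴿ stringWeight (p ∘ suc) u) *ᴿ weight (shift (length u) (p ∘ suc)) (∂* u (∂ false C))
    ≈⟨ *-assoc _ _ _ ⟩
  (1ᴿ -ᴿ p 0) *ᴿ (stringWeight (p ∘ suc) u *ᴿ weight (shift (length u) (p ∘ suc)) (∂* u (∂ false C)))
    ≲⟨ *-monoʳ (0≤1-p bias 0) (weight-∂* (bias ∘ suc) u (∂ false C)) ⟩
  (1ᴿ -ᴿ p 0) *ᴿ weight (p ∘ suc) (∂ false C)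
    ≲⟨ x≤y+x (0≤* (0≤p bias 0) (0≤weight (bias ∘ suc) (∂ true C))) ⟩
  _                                                                                          ≈⟨ weight-∂ p C ⟨
  weight p C                                                                                 ■

prepend : List Bool → 2^ω → 2^ω
prepend []      x n       = x n
prepend (b ∷ u) x zero    = b
prepend (b ∷ u) x (suc n) = prepend u x n

∈-∂* : ∀ {x} u C → ⟦ C ⟧ (prepend u x) → ⟦ ∂* u C ⟧ x
∈-∂* []      C h = h
∈-∂* (b ∷ u) C h = ∈-∂* u (∂ b C) (∈-∂ C refl h)

prepend∈ : ∀ u x → ⟦ just u ⟧ (prepend u x)
prepend∈ []      x = refl
prepend∈ (b ∷ u) x = cong (b ∷_) (prepend∈ u x)

prepend-beyond : ∀ u x n → prepend u x (length u ℕ.+ n) ≡ x n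
prepend-beyond []      x n = refl
prepend-beyond (b ∷ u) x n = prepend-beyond u x n

-- Greedy construction of two disjoint sequences avoiding given covers

module Greedy (em : ExcludedMiddle 0ℓ) {W κ : ℝ} (0<W : 0ᴿ <ᴿ W) (κ<W : κ <ᴿ W) where
  open Classical em

  *-monoʳ-< : ∀ {x y z} → 0ᴿ <ᴿ x → y <ᴿ z → x *ᴿ y <ᴿ x *ᴿ z
  *-monoʳ-< 0<x y<z = ≰⇒> (<⇒≱ y<z ∘ *-cancelˡ 0<x)

  +-mono-<-≤ : ∀ {x y u v} → x <ᴿ y → u ≤ᴿ v → x +ᴿ u <ᴿ y +ᴿ v
  +-mono-<-≤ {x} {y} {u} {v} x<y u≤v = gap≤⇒< (gap x<y) (gap>0 x<y) (
    (x +ᴿ u) +ᴿ fromℚ (gap x<y)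
      ≈⟨ ring (λ n → solve 3 (λ a b c → (a :+ b) :+ c := (a :+ c) :+ b) refl (seq x n) (seq u n) (gap x<y)) ⟩
    (x +ᴿ fromℚ (gap x<y)) +ᴿ u     ≲⟨ +-mono (gap≤ x<y) u≤v ⟩
    y +ᴿ v                          ■)

  total : (ℕ → ℝ) → (Bool → ℕ → Cyl) → ℕ → ℝ
  total p C N = ∑ (weight p ∘ C true) N +ᴿ ∑ (weight p ∘ C false) N

  -- In the application `W` is the weight of a fixed prefix, and `p` and `C` describe what follows
  -- it. As `κ < W`, the joint weight of the two covers stays below 1.
  Small : (ℕ → ℝ) → (Bool → ℕ → Cyl) → Set
  Small p C = ∀ N → W *ᴿ total p C N ≤ᴿ κ

  -- A stage of the construction: the probabilities of the remaining digits and, for each of the two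
  -- sequences, the sections of its cover along the digits already chosen.
  record State : Set where
    field
      p     : ℕ → ℝ
      C     : Bool → ℕ → Cyl
      bias  : Bias p
      small : Small p C
  open State

  move : (Bool → Bool) → (Bool → ℕ → Cyl) → Bool → ℕ → Cyl
  move b C side i = ∂ (b side) (C side i)

  -- The digit pairs (1,0), (0,1) and (0,0); every index from 2 on denotes the last one, so any
  -- natural number is a move.
  moves : ℕ → Bool → Bool
  moves 0 true  = true
  moves 0 false = false
  moves 1 true  = false
  moves 1 false = true
  moves (suc (suc _)) _ = false

  moves-disjoint : ∀ m → moves m true ∧ moves m false ≡ false
  moves-disjoint 0 = refl
  moves-disjoint 1 = refl
  moves-disjoint (suc (suc _)) = refl

  total-mono : ∀ {p C} → Bias p → ∀ {M N} → M ℕ.≤ N → total p C M ≤ᴿ total p C N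
  total-mono {C = C} bias M≤N = +-mono (∑-monoʳ (λ i → 0≤weight bias (C true i)) M≤N) (∑-monoʳ (λ i → 0≤weight bias (C false i)) M≤N)

  -- The three moves have probabilities p 0, p 0 and 1 - 2 p 0, so that
  -- either coordinate is `true` with probability p 0.
  average : ∀ p C N → W *ᴿ total p C N ≈ᴿ
    p 0 *ᴿ (W *ᴿ total (p ∘ suc) (move (moves 0) C) N) +ᴿ
    (p 0 *ᴿ (W *ᴿ total (p ∘ suc) (move (moves 1) C) N) +ᴿ
     (1ᴿ -ᴿ (p 0 +ᴿ p 0)) *ᴿ (W *ᴿ total (p ∘ suc) (move (moves 2) C) N))
  average p C N = ≈-trans (expand (C true) (C false)) regroup
    where
    A : Bool → Bool → ℝ
    A side b = ∑ (weight (p ∘ suc) ∘ ∂ b ∘ C side) N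
    split : ∀ D → ∑ (weight p ∘ D) N ≈ᴿ
      p 0 *ᴿ ∑ (weight (p ∘ suc) ∘ ∂ true ∘ D) N +ᴿ (1ᴿ -ᴿ p 0) *ᴿ ∑ (weight (p ∘ suc) ∘ ∂ false ∘ D) N
    split D = ≈-trans (∑-cong (weight-∂ p ∘ D) N)
      (≈-trans (∑-+ (λ i → p 0 *ᴿ weight (p ∘ suc) (∂ true (D i))) (λ i → (1ᴿ -ᴿ p 0) *ᴿ weight (p ∘ suc) (∂ false (D i))) N)
        (+-cong (∑-* (p 0) (weight (p ∘ suc) ∘ ∂ true ∘ D) N) (∑-* (1ᴿ -ᴿ p 0) (weight (p ∘ suc) ∘ ∂ false ∘ D) N)))
    expand : ∀ D D′ → W *ᴿ (∑ (weight p ∘ D) N +ᴿ ∑ (weight p ∘ D′) N) ≈ᴿ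
      W *ᴿ ((p 0 *ᴿ ∑ (weight (p ∘ suc) ∘ ∂ true ∘ D) N +ᴿ (1ᴿ -ᴿ p 0) *ᴿ ∑ (weight (p ∘ suc) ∘ ∂ false ∘ D) N) +ᴿ
            (p 0 *ᴿ ∑ (weight (p ∘ suc) ∘ ∂ true ∘ D′) N +ᴿ (1ᴿ -ᴿ p 0) *ᴿ ∑ (weight (p ∘ suc) ∘ ∂ false ∘ D′) N))
    expand D D′ = *-congʳ (<⇒≤ 0<W) (+-cong (split D) (split D′))
    regroup : W *ᴿ ((p 0 *ᴿ A true true +ᴿ (1ᴿ -ᴿ p 0) *ᴿ A true false) +ᴿ (p 0 *ᴿ A false true +ᴿ (1ᴿ -ᴿ p 0) *ᴿ A false false)) ≈ᴿ
      p 0 *ᴿ (W *ᴿ (A true true +ᴿ A false false)) +ᴿ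
      (p 0 *ᴿ (W *ᴿ (A true false +ᴿ A false true)) +ᴿ
       (1ᴿ -ᴿ (p 0 +ᴿ p 0)) *ᴿ (W *ᴿ (A true false +ᴿ A false false)))
    regroup = ring (λ n → solve 6 (λ w q a b c d →
        w :* ((q :* a :+ (con 1ℚ :+ :- q) :* b) :+ (q :* c :+ (con 1ℚ :+ :- q) :* d)) :=
        q :* (w :* (a :+ d)) :+ (q :* (w :* (b :+ c)) :+ (con 1ℚ :+ :- (q :+ q)) :* (w :* (b :+ d)))) refl
      (seq W n) (seq (p 0) n) (seq (A true true) n) (seq (A true false) n) (seq (A false true) n) (seq (A false false) n))

  -- If all moves failed, then, as totals grow with `N`, they would exceed `κ` at a common `N`, and
  -- so would their convex combination in `average`. Strictness comes from move 0, since `q` is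
  -- positive while `1 - 2q` may vanish.
  step : (st : State) → ∃[ m ] Small (p st ∘ suc) (move (moves m) (C st))
  step st = ¬¬-elim λ none →
    let fails = λ m → ¬∀⇒∃¬ (λ h → none (m , h))
        N = proj₁ (fails 0) ℕ.⊔ (proj₁ (fails 1) ℕ.⊔ proj₁ (fails 2))
        q = p st 0
        S = W *ᴿ total (p st) (C st) N
        V = λ m → W *ᴿ total (p st ∘ suc) (move (moves m) (C st)) N
        V> : ∀ m → proj₁ (fails m) ℕ.≤ N → S <ᴿ V m
        V> m le = ≤-<-trans (small st N) (<-≤-trans (≰⇒> (proj₂ (fails m)))
          (*-monoʳ (<⇒≤ 0<W) (total-mono {C = move (moves m) (C st)} (bias st ∘ suc) le)))
        0≤1-2q : 0ᴿ ≤ᴿ 1ᴿ -ᴿ (q +ᴿ q)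
        0≤1-2q = ≤⇒0≤- (≤-trans (+-mono (proj₂ (bias st 0)) (proj₂ (bias st 0))) (≤-pointwise (λ _ → ℚ.≤-refl)))
    in <⇒≱
      (≤-<-trans {y = q *ᴿ S +ᴿ (q *ᴿ S +ᴿ (1ᴿ -ᴿ (q +ᴿ q)) *ᴿ S)}
        (proj₁ (ring (λ n → solve 2 (λ q s → s := q :* s :+ (q :* s :+ (con 1ℚ :+ :- (q :+ q)) :* s)) refl (seq q n) (seq S n))))
        (+-mono-<-≤ {v = q *ᴿ V 1 +ᴿ (1ᴿ -ᴿ (q +ᴿ q)) *ᴿ V 2}
          (*-monoʳ-< (0<p (bias st) 0) (V> 0 (ℕ.m≤m⊔n _ _)))
          (+-mono (*-monoʳ (0≤p (bias st) 0) (<⇒≤ (V> 1 (ℕ.≤-trans (ℕ.m≤m⊔n (proj₁ (fails 1)) (proj₁ (fails 2))) (ℕ.m≤n⊔m (proj₁ (fails 0)) _)))))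
                  (*-monoʳ 0≤1-2q (<⇒≤ (V> 2 (ℕ.≤-trans (ℕ.m≤n⊔m (proj₁ (fails 1)) (proj₁ (fails 2))) (ℕ.m≤n⊔m (proj₁ (fails 0)) _))))))))
      (proj₂ (average (p st) (C st) N))

  next : State → State
  p     (next st) = p st ∘ suc
  C     (next st) = move (moves (proj₁ (step st))) (C st)
  bias  (next st) = bias st ∘ suc
  small (next st) = proj₂ (step st)

  path : State → Bool → 2^ω
  path st side zero    = moves (proj₁ (step st)) side
  path st side (suc n) = path (next st) side n

  path-disjoint : ∀ st n → path st true n ∧ path st false n ≡ false
  path-disjoint st zero    = moves-disjoint (proj₁ (step st))
  path-disjoint st (suc n) = path-disjoint (next st) n

  weight≤total : ∀ (st : State) side i → weight (p st) (C st side i) ≤ᴿ total (p st) (C st) (suc i)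
  weight≤total st true i  = ≤-trans (term≤∑ (λ j → 0≤weight (bias st) (C st true j)) i)
    (x≤x+y (∑-nonneg (λ j → 0≤weight (bias st) (C st false j)) (suc i)))
  weight≤total st false i = ≤-trans (term≤∑ (λ j → 0≤weight (bias st) (C st false j)) i)
    (x≤y+x (∑-nonneg (λ j → 0≤weight (bias st) (C st true j)) (suc i)))

  -- Following a string `s` of the cover to its end would turn it into the whole space, a section of
  -- weight 1, and `Small` would give `W ≤ κ`.
  path-avoids : ∀ st side i → ¬ ⟦ C st side i ⟧ (path st side)
  path-avoids st side i h with C st side i in eq
  ... | just s = avoid st s eq h
    where
    ∂-∷ : ∀ b s → ∂ b (just (b ∷ s)) ≡ just s
    ∂-∷ true  s = refl
    ∂-∷ false s = refl
    avoid : ∀ st s → C st side i ≡ just s → ¬ ⟦ just s ⟧ (path st side)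
    avoid st [] eq _ = <⇒≱ κ<W (
      W                                       ≈⟨ *-identityʳ W ⟨
      W *ᴿ 1ᴿ
        ≲⟨ *-monoʳ (<⇒≤ 0<W) (subst (λ D → weight (p st) D ≤ᴿ total (p st) (C st) (suc i)) eq (weight≤total st side i)) ⟩
      W *ᴿ total (p st) (C st) (suc i)        ≲⟨ small st (suc i) ⟩
      κ                                       ■)
    avoid st (b ∷ s) eq h = avoid (next st) s
      (trans (cong₂ ∂ (List.∷-injectiveˡ h) eq) (∂-∷ b s)) (List.∷-injectiveʳ h)

-- Filters

-- Points below `n` that some member of `F` misses are removed one at a time by intersecting with
-- such a member. What remains lies in every member and generates `F`.
finite-member⇒principal : ExcludedMiddle 0ℓ → ∀ {F} → IsFilter F → ∀ n A → F A →
  (∀ i → i ∈ω A → i ℕ.< n ⊎ (∀ X → F X → i ∈ω X)) → Principal F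
finite-member⇒principal em isF zero A A∈F h = A , λ X → mk⇔
  (λ X∈F i i∈A → [ (λ ()) , (λ k → k X X∈F) ]′ (h i i∈A))
  (λ A⊆X → IsFilter.upward isF A⊆X A∈F)
finite-member⇒principal em {F} isF (suc n) A A∈F h with em {∀ X → F X → n ∈ω X}
... | yes k = finite-member⇒principal em isF n A A∈F λ i i∈A → shrink i (h i i∈A)
  where
  shrink : ∀ i → i ℕ.< suc n ⊎ (∀ X → F X → i ∈ω X) → i ℕ.< n ⊎ (∀ X → F X → i ∈ω X)
  shrink i (inj₂ l) = inj₂ l
  shrink i (inj₁ i<1+n) with ℕ.m<1+n⇒m<n∨m≡n i<1+n
  ... | inj₁ i<n  = inj₁ i<n
  ... | inj₂ refl = inj₂ k
... | no ¬k with Classical.¬∀⇒∃¬ em ¬k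
... | X , ¬l with Classical.¬∀⇒∃¬ em ¬l
... | X∈F , n∉X = finite-member⇒principal em isF n (A ∩ω X) (IsFilter.∩-closed isF A∈F X∈F)
  λ i i∈ → shrink i (∧-true (A i) i∈) (h i (proj₁ (∧-true (A i) i∈)))
  where
  ∧-true : ∀ a {b} → a ∧ b ≡ true → a ≡ true × b ≡ true
  ∧-true true eq = refl , eq
  shrink : ∀ i → A i ≡ true × X i ≡ true → i ℕ.< suc n ⊎ (∀ X → F X → i ∈ω X) → i ℕ.< n ⊎ (∀ X → F X → i ∈ω X)
  shrink i _ (inj₂ l) = inj₂ l
  shrink i (_ , i∈X) (inj₁ i<1+n) with ℕ.m<1+n⇒m<n∨m≡n i<1+n
  ... | inj₁ i<n  = inj₁ i<n
  ... | inj₂ refl = ⊥-elim (n∉X i∈X)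

-- Measurable nonprincipal filters are null

module _ (em : ExcludedMiddle 0ℓ) {p : ℕ → ℝ} (bias : Bias p) {F : Pred 2^ω 0ℓ} (isF : IsFilter F) where
  open Classical em
  open Measure em bias

  -- Two sequences through `u` avoid the cover of the complement and hence lie in `F`, while they
  -- are disjoint beyond `u`. The cover is charged once for each of them, hence the factor `½`.
  dense-cylinder⇒principal : ∀ {c} u → CoverBound p (⟦ just u ⟧ ∩ ∁ F) c → c <ᴿ ½ᴿ *ᴿ stringWeight p u → Principal F
  dense-cylinder⇒principal {c} u (D , covers , D≤c) c<½W =
    finite-member⇒principal em isF (length u) (X true ∩ω X false)
      (IsFilter.∩-closed isF (X∈F true) (X∈F false)) support
    where
    W : ℝ
    W = stringWeight p u
    0<W : 0ᴿ <ᴿ W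
    0<W = 0<stringWeight bias u
    κ<W : c +ᴿ c <ᴿ W
    κ<W = gap≤⇒< (gap c<½W) (gap>0 c<½W) (
      (c +ᴿ c) +ᴿ fromℚ (gap c<½W)     ≈⟨ +-assocᴿ _ _ _ ⟩
      c +ᴿ (c +ᴿ fromℚ (gap c<½W))     ≲⟨ +-mono (<⇒≤ c<½W) (gap≤ c<½W) ⟩
      ½ᴿ *ᴿ W +ᴿ ½ᴿ *ᴿ W
        ≈⟨ ring (λ n → solve 1 (λ w → con ½ :* w :+ con ½ :* w := w) refl (seq W n)) ⟩
      W                                ■)
    open Greedy em 0<W κ<W
    start : State
    start = record
      { p     = shift (length u) p
      ; C     = λ _ i → ∂* u (D i)
      ; bias  = bias ∘ (length u ℕ.+_)
      ; small = λ N → let w = weight (shift (length u) p) ∘ ∂* u ∘ D in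
          W *ᴿ (∑ w N +ᴿ ∑ w N)                                ≈⟨ *-distribˡ W _ _ ⟩
          W *ᴿ ∑ w N +ᴿ W *ᴿ ∑ w N                             ≈⟨ +-cong (∑-* W w N) (∑-* W w N) ⟨
          ∑ (λ i → W *ᴿ w i) N +ᴿ ∑ (λ i → W *ᴿ w i) N
            ≲⟨ +-mono (∑-mono (weight-∂* bias u ∘ D) N) (∑-mono (weight-∂* bias u ∘ D) N) ⟩
          ∑ (weight p ∘ D) N +ᴿ ∑ (weight p ∘ D) N             ≲⟨ +-mono (D≤c N) (D≤c N) ⟩
          c +ᴿ c                                               ■
      }
    X : Bool → 2^ω
    X side = prepend u (path start side)
    X∈F : ∀ side → F (X side)
    X∈F side = ¬¬-elim λ X∉F →
      let (i , h) = covers (X side) (prepend∈ u _ , X∉F)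
      in path-avoids start side i (∈-∂* u (D i) h)
    beyond : ∀ k → (X true ∩ω X false) (length u ℕ.+ k) ≡ false
    beyond k = trans (cong₂ _∧_ (prepend-beyond u _ k) (prepend-beyond u _ k)) (path-disjoint start k)
    support : ∀ i → i ∈ω X true ∩ω X false → i ℕ.< length u ⊎ (∀ Y → F Y → i ∈ω Y)
    support i i∈ = map₂ (λ n≤i → let (k , eq) = ℕ.m≤n⇒∃[o]m+o≡n n≤i in
      contradiction (trans (sym i∈) (trans (cong (X true ∩ω X false) (sym eq)) (beyond k))) λ ()) (ℕ.<-≤-connex i (length u))

  -- The complement of `F` fills at least half of each cylinder, and measurability leaves at most
  -- half for `F`. Replacing each cylinder of a cover by a cover of its trace on `F` shrinks the
  -- weight by a fixed factor, which forces the infimum `r` to be 0.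
  measurable⇒null : Measurable p F → ¬ Principal F → Null p F
  measurable⇒null measurable nonprincipal ε 0<ε = μ-cover μF (≤-<-trans r≤0 (fromℚ-pos 0<ε))
    where
    -- The value one half is an infimum; `¾` leaves room for an actual cover. Its inverse is `4/3`,
    -- and `1/3` is the excess of that over 1.
    ¼ ¾ 1/3 4/3 : ℚ
    ¼   = ½ ℚ.* ½
    ¾   = ½ ℚ.+ ¼
    1/3 = + 1 ℚ./ 3
    4/3 = 1ℚ ℚ.+ 1/3
    r : ℝ
    r = proj₁ (outer-measure F)
    μF : μ[ p ] F ≈ r
    μF = proj₂ (outer-measure F)
    thin : ∀ C → CoverBound p (⟦ C ⟧ ∩ F) (fromℚ ¾ *ᴿ weight p C)
    thin nothing  = cover-mono (λ _ ()) (proj₂ (*-zeroʳ (fromℚ ¾))) cover-∅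
    thin (just u) =
      let W        = stringWeight p u
          (R , μR) = outer-measure ⟦ just u ⟧
          (s , μs) = outer-measure (⟦ just u ⟧ ∩ F)
          (t , μt) = outer-measure (⟦ just u ⟧ ∩ ∁ F)
          ½W≤t     = proj₂ μt (½ᴿ *ᴿ W) λ c cover → ≮⇒≥ (nonprincipal ∘ dense-cylinder⇒principal u cover)
          s+½W≤W : s +ᴿ ½ᴿ *ᴿ W ≤ᴿ W
          s+½W≤W = ≤-trans (+-monoʳ s ½W≤t) (≤-trans (proj₂ (measurable ⟦ just u ⟧ R s t μR μs μt)) (proj₁ μR W (cover-cylinder bias u)))
          s≤½W : s ≤ᴿ ½ᴿ *ᴿ W
          s≤½W = 0≤-⇒≤ (≤-trans (≤⇒0≤- s+½W≤W) (proj₁ (ring (λ n →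
            solve 2 (λ s w → w :+ :- (s :+ con ½ :* w) := con ½ :* w :+ :- s) refl (seq s n) (seq W n)))))
          (q , 0<q , q≤¼W) = rational-below (0<* (fromℚ-pos (ℚ.positive⁻¹ ¼)) (0<stringWeight bias u))
      in μ-cover μs (gap≤⇒< q 0<q (
           s +ᴿ fromℚ q                    ≲⟨ +-mono s≤½W q≤¼W ⟩
           ½ᴿ *ᴿ W +ᴿ fromℚ ¼ *ᴿ W         ≈⟨ ring (λ n → ℚ.*-distribʳ-+ (seq W n) ½ ¼) ⟨
           fromℚ ¾ *ᴿ W                    ■))
    shrink : ∀ c → CoverBound p F c → CoverBound p F (fromℚ ¾ *ᴿ c)
    shrink c (C , covers , C≤c) = cover-mono (λ x x∈F → let (i , h) = covers x x∈F in i , h , x∈F) ≤-refl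
      (cover-⋃ bias {λ i → ⟦ C i ⟧ ∩ F} (thin ∘ C) (λ N →
        ≤-trans (proj₁ (∑-* (fromℚ ¾) (weight p ∘ C) N)) (*-monoʳ (fromℚ-mono (ℚ.nonNegative⁻¹ ¾)) (C≤c N))))
    4/3r≤r : fromℚ 4/3 *ᴿ r ≤ᴿ r
    4/3r≤r = proj₂ μF _ λ c cover →
      fromℚ 4/3 *ᴿ r
        ≲⟨ *-monoʳ (fromℚ-mono (ℚ.nonNegative⁻¹ 4/3)) (proj₁ μF _ (shrink c cover)) ⟩
      fromℚ 4/3 *ᴿ (fromℚ ¾ *ᴿ c)
        ≈⟨ ring (λ n → trans (sym (ℚ.*-assoc 4/3 ¾ (seq c n))) (ℚ.*-identityˡ (seq c n))) ⟩
      c                                     ■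
    r≤0 : r ≤ᴿ 0ᴿ
    r≤0 = ≮⇒≥ λ 0<r →
      let (q , 0<q , q≤) = rational-below (0<* (fromℚ-pos (ℚ.positive⁻¹ 1/3)) 0<r)
      in <⇒≱ (gap≤⇒< {r} {fromℚ 4/3 *ᴿ r} q 0<q (
           r +ᴿ fromℚ q                ≲⟨ +-monoʳ r q≤ ⟩
           r +ᴿ fromℚ 1/3 *ᴿ r         ≈⟨ +-cong (*-identityˡ r) ≈-refl ⟨
           1ᴿ *ᴿ r +ᴿ fromℚ 1/3 *ᴿ r   ≈⟨ ring (λ n → ℚ.*-distribʳ-+ (seq r n) 1ℚ 1/3) ⟨
           fromℚ 4/3 *ᴿ r              ■)) 4/3r≤r

-- Expectations over random strings

avg : (ℕ → ℝ) → ℕ → (List Bool → ℝ) → ℝ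
avg p zero    f = f []
avg p (suc k) f = p 0 *ᴿ avg (p ∘ suc) k (f ∘ (true ∷_)) +ᴿ (1ᴿ -ᴿ p 0) *ᴿ avg (p ∘ suc) k (f ∘ (false ∷_))

avg-mono : ∀ {p} → Bias p → ∀ k {f g} → (∀ s → length s ≡ k → f s ≤ᴿ g s) → avg p k f ≤ᴿ avg p k g
avg-mono bias zero    h = h [] refl
avg-mono bias (suc k) h = +-mono
  (*-monoʳ (0≤p bias 0) (avg-mono (bias ∘ suc) k (λ s eq → h (true ∷ s) (cong suc eq))))
  (*-monoʳ (0≤1-p bias 0) (avg-mono (bias ∘ suc) k (λ s eq → h (false ∷ s) (cong suc eq))))

avg-cong : ∀ {p} → Bias p → ∀ k {f g} → (∀ s → f s ≈ᴿ g s) → avg p k f ≈ᴿ avg p k g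
avg-cong bias k h = avg-mono bias k (λ s _ → proj₁ (h s)) , avg-mono bias k (λ s _ → proj₂ (h s))

mix-same : ∀ q x → q *ᴿ x +ᴿ (1ᴿ -ᴿ q) *ᴿ x ≈ᴿ x
mix-same q x = ring (λ n → solve 2 (λ q x → q :* x :+ (con 1ℚ :+ :- q) :* x := x) refl (seq q n) (seq x n))

avg-const : ∀ {p} → Bias p → ∀ k x → avg p k (λ _ → x) ≈ᴿ x
avg-const bias zero x = ≈-refl
avg-const {p} bias (suc k) x = ≈-trans
  (+-cong (*-congʳ (0≤p bias 0) (avg-const (bias ∘ suc) k x)) (*-congʳ (0≤1-p bias 0) (avg-const (bias ∘ suc) k x)))
  (mix-same (p 0) x)

avg-+ : ∀ {p} → Bias p → ∀ k f g → avg p k (λ s → f s +ᴿ g s) ≈ᴿ avg p k f +ᴿ avg p k g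
avg-+ bias zero f g = ≈-refl
avg-+ {p} bias (suc k) f g = ≈-trans
  (+-cong (*-congʳ (0≤p bias 0) (avg-+ (bias ∘ suc) k (f ∘ (true ∷_)) (g ∘ (true ∷_))))
          (*-congʳ (0≤1-p bias 0) (avg-+ (bias ∘ suc) k (f ∘ (false ∷_)) (g ∘ (false ∷_)))))
  (≈-trans (+-cong (*-distribˡ (p 0) _ _) (*-distribˡ (1ᴿ -ᴿ p 0) _ _)) (+-interchange _ _ _ _))

*-left-comm : ∀ x y z → x *ᴿ (y *ᴿ z) ≈ᴿ y *ᴿ (x *ᴿ z)
*-left-comm x y z = ring (λ n → solve 3 (λ a b c → a :* (b :* c) := b :* (a :* c)) refl (seq x n) (seq y n) (seq z n))

avg-* : ∀ {p} → Bias p → ∀ k x f → avg p k (λ s → x *ᴿ f s) ≈ᴿ x *ᴿ avg p k f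
avg-* bias zero x f = ≈-refl
avg-* {p} bias (suc k) x f = ≈-trans
  (+-cong (≈-trans (*-congʳ (0≤p bias 0) (avg-* (bias ∘ suc) k x (f ∘ (true ∷_)))) (*-left-comm (p 0) x _))
          (≈-trans (*-congʳ (0≤1-p bias 0) (avg-* (bias ∘ suc) k x (f ∘ (false ∷_)))) (*-left-comm (1ᴿ -ᴿ p 0) x _)))
  (≈-sym (*-distribˡ x _ _))

avg-swap : ∀ {p q} → Bias p → Bias q → ∀ k l (f : List Bool → List Bool → ℝ) →
  avg p k (λ s → avg q l (f s)) ≈ᴿ avg q l (λ t → avg p k (λ s → f s t))
avg-swap bias bias′ zero l f = ≈-refl
avg-swap {p} {q} bias bias′ (suc k) l f = ≈-trans
  (+-cong (*-congʳ (0≤p bias 0) (avg-swap (bias ∘ suc) bias′ k l (f ∘ (true ∷_))))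
          (*-congʳ (0≤1-p bias 0) (avg-swap (bias ∘ suc) bias′ k l (f ∘ (false ∷_)))))
  (≈-sym (≈-trans (avg-+ bias′ l _ _) (+-cong (avg-* bias′ l (p 0) _) (avg-* bias′ l (1ᴿ -ᴿ p 0) _))))

avg-++ : ∀ {p} → Bias p → ∀ m k f → avg p (m ℕ.+ k) f ≈ᴿ avg p m (λ r → avg (shift m p) k (λ s → f (r ++ s)))
avg-++ bias zero    k f = ≈-refl
avg-++ bias (suc m) k f = +-cong
  (*-congʳ (0≤p bias 0) (avg-++ (bias ∘ suc) m k (f ∘ (true ∷_))))
  (*-congʳ (0≤1-p bias 0) (avg-++ (bias ∘ suc) m k (f ∘ (false ∷_))))

0≤avg : ∀ {p} → Bias p → ∀ k {f} → (∀ s → 0ᴿ ≤ᴿ f s) → 0ᴿ ≤ᴿ avg p k f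
0≤avg bias k h = ≤-trans (proj₂ (avg-const bias k 0ᴿ)) (avg-mono bias k (λ s _ → h s))

-- Since p n ≤ 1 - p n, the all-ones string has the least weight.
leastWeight : (ℕ → ℝ) → ℕ → ℝ
leastWeight p zero    = 1ᴿ
leastWeight p (suc m) = p 0 *ᴿ leastWeight (p ∘ suc) m

0<leastWeight : ∀ {p} → Bias p → ∀ m → 0ᴿ <ᴿ leastWeight p m
0<leastWeight bias zero    = fromℚ-pos (ℚ.positive⁻¹ 1ℚ)
0<leastWeight bias (suc m) = 0<* (0<p bias 0) (0<leastWeight (bias ∘ suc) m)

-- The string `r` is at least as likely as the all-ones string, and the other values of `f` only
-- add. An average thus controls each single value.
leastWeight*≤avg : ∀ {p} → Bias p → ∀ {f} → (∀ s → 0ᴿ ≤ᴿ f s) → ∀ r → leastWeight p (length r) *ᴿ f r ≤ᴿ avg p (length r) f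
leastWeight*≤avg bias 0≤f [] = proj₁ (*-identityˡ _)
leastWeight*≤avg {p} bias {f} 0≤f (true ∷ r) =
  (p 0 *ᴿ leastWeight (p ∘ suc) (length r)) *ᴿ f (true ∷ r)        ≈⟨ *-assoc _ _ _ ⟩
  p 0 *ᴿ (leastWeight (p ∘ suc) (length r) *ᴿ f (true ∷ r))
    ≲⟨ *-monoʳ (0≤p bias 0) (leastWeight*≤avg (bias ∘ suc) (0≤f ∘ (true ∷_)) r) ⟩
  p 0 *ᴿ avg (p ∘ suc) (length r) (f ∘ (true ∷_))
    ≲⟨ x≤x+y (0≤* (0≤1-p bias 0) (0≤avg (bias ∘ suc) (length r) (0≤f ∘ (false ∷_)))) ⟩
  avg p (suc (length r)) f                                         ■
leastWeight*≤avg {p} bias {f} 0≤f (false ∷ r) =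
  (p 0 *ᴿ leastWeight (p ∘ suc) (length r)) *ᴿ f (false ∷ r)       ≈⟨ *-assoc _ _ _ ⟩
  p 0 *ᴿ (leastWeight (p ∘ suc) (length r) *ᴿ f (false ∷ r))
    ≲⟨ *-monoʳ (0≤p bias 0) (leastWeight*≤avg (bias ∘ suc) (0≤f ∘ (false ∷_)) r) ⟩
  p 0 *ᴿ avg (p ∘ suc) (length r) (f ∘ (false ∷_))
    ≲⟨ *-monoˡ (0≤avg (bias ∘ suc) (length r) (0≤f ∘ (false ∷_)))
                                                                       (≤-trans (proj₂ (bias 0)) (½≤1- (proj₂ (bias 0)))) ⟩
  (1ᴿ -ᴿ p 0) *ᴿ avg (p ∘ suc) (length r) (f ∘ (false ∷_))
    ≲⟨ x≤y+x (0≤* (0≤p bias 0) (0≤avg (bias ∘ suc) (length r) (0≤f ∘ (true ∷_)))) ⟩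
  avg p (suc (length r)) f                                         ■

Extends : List Bool → List Bool → Set
Extends s d = ∃[ e ] s ≡ d ++ e

applyUpTo-+ : ∀ {A : Set} (x : ℕ → A) m k → applyUpTo x (m ℕ.+ k) ≡ applyUpTo x m ++ applyUpTo (shift m x) k
applyUpTo-+ x zero    k = refl
applyUpTo-+ x (suc m) k = cong (x 0 ∷_) (applyUpTo-+ (x ∘ suc) m k)

∈⇒Extends : ∀ {x n} d → length d ℕ.≤ n → ⟦ just d ⟧ x → Extends (applyUpTo x n) d
∈⇒Extends {x} d le h with ℕ.m≤n⇒∃[o]m+o≡n le
... | k , refl = applyUpTo (shift (length d) x) k , trans (applyUpTo-+ x (length d) k) (cong (_++ applyUpTo (shift (length d) x) k) h)

-- Probabilities of events about finite strings

module Indicator (em : ExcludedMiddle 0ℓ) where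
  open Classical em

  ind : Set → ℝ
  ind A with em {A}
  ... | yes _ = 1ᴿ
  ... | no _  = 0ᴿ

  0≤ind : ∀ A → 0ᴿ ≤ᴿ ind A
  0≤ind A with em {A}
  ... | yes _ = 0≤1
  ... | no _  = ≤-refl

  ind≤1 : ∀ A → ind A ≤ᴿ 1ᴿ
  ind≤1 A with em {A}
  ... | yes _ = ≤-refl
  ... | no _  = 0≤1

  1≤ind : ∀ {A} → A → 1ᴿ ≤ᴿ ind A
  1≤ind {A} a with em {A}
  ... | yes _ = ≤-refl
  ... | no ¬a = contradiction a ¬a

  ind-elim : ∀ {A x} → 0ᴿ ≤ᴿ x → (A → 1ᴿ ≤ᴿ x) → ind A ≤ᴿ x
  ind-elim {A} 0≤x h with em {A}
  ... | yes a = h a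
  ... | no _  = 0≤x

  ind-mono : ∀ {A B} → (A → B) → ind A ≤ᴿ ind B
  ind-mono {B = B} h = ind-elim (0≤ind B) (1≤ind ∘ h)

  ind-∪ : ∀ {A B C} → (A → B ⊎ C) → ind A ≤ᴿ ind B +ᴿ ind C
  ind-∪ {A} {B} {C} h = ind-elim (0≤+ (0≤ind B) (0≤ind C)) λ a → [
    (λ b → ≤-trans (1≤ind b) (x≤x+y (0≤ind C))) , (λ c → ≤-trans (1≤ind c) (x≤y+x (0≤ind B))) ]′ (h a)

  Pr : (ℕ → ℝ) → ℕ → Pred (List Bool) 0ℓ → ℝ
  Pr p k P = avg p k (λ s → ind (P s))

  Pr-mono : ∀ {p} → Bias p → ∀ k {P Q : Pred (List Bool) 0ℓ} → (∀ s → P s → Q s) → Pr p k P ≤ᴿ Pr p k Q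
  Pr-mono bias k h = avg-mono bias k (λ s _ → ind-mono (h s))

  Pr-∪ : ∀ {p} → Bias p → ∀ k {P Q R : Pred (List Bool) 0ℓ} → (∀ s → P s → Q s ⊎ R s) →
    Pr p k P ≤ᴿ Pr p k Q +ᴿ Pr p k R
  Pr-∪ bias k h = ≤-trans (avg-mono bias k (λ s _ → ind-∪ (h s))) (proj₁ (avg-+ bias k _ _))

  Pr-∅ : ∀ {p} → Bias p → ∀ k {P : Pred (List Bool) 0ℓ} → (∀ s → ¬ P s) → Pr p k P ≤ᴿ 0ᴿ
  Pr-∅ bias k h = ≤-trans (avg-mono bias k (λ s _ → ind-elim ≤-refl (⊥-elim ∘ h s))) (proj₁ (avg-const bias k 0ᴿ))

  Pr≤1 : ∀ {p} → Bias p → ∀ k {P : Pred (List Bool) 0ℓ} → Pr p k P ≤ᴿ 1ᴿ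
  Pr≤1 bias k {P} = ≤-trans (avg-mono bias k (λ s _ → ind≤1 (P s))) (proj₁ (avg-const bias k 1ᴿ))

  0≤Pr : ∀ {p} → Bias p → ∀ k {P : Pred (List Bool) 0ℓ} → 0ᴿ ≤ᴿ Pr p k P
  0≤Pr bias k {P} = 0≤avg bias k (λ s → 0≤ind (P s))

  Pr-Extends : ∀ {p} → Bias p → ∀ k d → Pr p k (λ s → Extends s d) ≤ᴿ stringWeight p d
  Pr-Extends bias k [] = Pr≤1 bias k
  Pr-Extends bias zero (b ∷ d) = ind-elim (0≤stringWeight bias (b ∷ d)) λ ()
  Pr-Extends {p} bias (suc k) (true ∷ d) =
    p 0 *ᴿ avg (p ∘ suc) k (λ s → ind (Extends (true ∷ s) (true ∷ d))) +ᴿ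
      (1ᴿ -ᴿ p 0) *ᴿ avg (p ∘ suc) k (λ s → ind (Extends (false ∷ s) (true ∷ d)))
        ≲⟨ +-mono (*-monoʳ (0≤p bias 0) (≤-trans (Pr-mono (bias ∘ suc) k (λ s (e , eq) → e , List.∷-injectiveʳ eq)) (Pr-Extends (bias ∘ suc) k d)))
                  (*-monoʳ (0≤1-p bias 0) (Pr-∅ (bias ∘ suc) k (λ { s (e , ()) }))) ⟩
    p 0 *ᴿ stringWeight (p ∘ suc) d +ᴿ (1ᴿ -ᴿ p 0) *ᴿ 0ᴿ     ≈⟨ +-cong ≈-refl (*-zeroʳ _) ⟩
    p 0 *ᴿ stringWeight (p ∘ suc) d +ᴿ 0ᴿ                    ≈⟨ +-identityʳ _ ⟩
    p 0 *ᴿ stringWeight (p ∘ suc) d                          ■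
  Pr-Extends {p} bias (suc k) (false ∷ d) =
    p 0 *ᴿ avg (p ∘ suc) k (λ s → ind (Extends (true ∷ s) (false ∷ d))) +ᴿ
      (1ᴿ -ᴿ p 0) *ᴿ avg (p ∘ suc) k (λ s → ind (Extends (false ∷ s) (false ∷ d)))
        ≲⟨ +-mono (*-monoʳ (0≤p bias 0) (Pr-∅ (bias ∘ suc) k (λ { s (e , ()) })))
                  (*-monoʳ (0≤1-p bias 0) (≤-trans (Pr-mono (bias ∘ suc) k (λ s (e , eq) → e , List.∷-injectiveʳ eq)) (Pr-Extends (bias ∘ suc) k d))) ⟩
    p 0 *ᴿ 0ᴿ +ᴿ (1ᴿ -ᴿ p 0) *ᴿ stringWeight (p ∘ suc) d     ≈⟨ +-cong (*-zeroʳ _) ≈-refl ⟩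
    0ᴿ +ᴿ (1ᴿ -ᴿ p 0) *ᴿ stringWeight (p ∘ suc) d            ≈⟨ +-identityˡ _ ⟩
    (1ᴿ -ᴿ p 0) *ᴿ stringWeight (p ∘ suc) d                  ■

  Pr-list : ∀ {p} → Bias p → ∀ k l → Pr p k (λ s → Any (Extends s) l) ≤ᴿ listWeight p l
  Pr-list bias k []      = Pr-∅ bias k (λ s ())
  Pr-list bias k (d ∷ l) = ≤-trans (Pr-∪ bias k (λ { s (here h) → inj₁ h ; s (there h) → inj₂ h }))
    (+-mono (Pr-Extends bias k d) (Pr-list bias k l))

  Pr-∃< : ∀ {p} → Bias p → ∀ k {P : ℕ → Pred (List Bool) 0ℓ} {c : ℕ → ℝ} → (∀ i → Pr p k (P i) ≤ᴿ c i) →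
    ∀ K → Pr p k (λ s → ∃[ i ] i ℕ.< K × P i s) ≤ᴿ ∑ c K
  Pr-∃< bias k h zero    = Pr-∅ bias k (λ { s (i , () , _) })
  Pr-∃< bias k {P} h (suc K) = ≤-trans
    (Pr-∪ bias k {Q = λ s → ∃[ i ] i ℕ.< K × P i s} {R = P K} last)
    (+-mono (Pr-∃< bias k h K) (h K))
    where
    last : ∀ s → ∃[ i ] i ℕ.< suc K × P i s → (∃[ i ] i ℕ.< K × P i s) ⊎ P K s
    last s (i , i<1+K , h) with ℕ.m<1+n⇒m<n∨m≡n i<1+K
    ... | inj₁ i<K  = inj₁ (i , i<K , h)
    ... | inj₂ refl = inj₂ h

  -- Markov's inequality: `θ` times the indicator of `θ ≤ f` lies below `f`, and a mean of at most
  -- `θ * θ` lets one factor cancel.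
  markov : ∀ {p θ} → Bias p → ∀ k {f} → 0ᴿ <ᴿ θ → (∀ s → 0ᴿ ≤ᴿ f s) → avg p k f ≤ᴿ θ *ᴿ θ →
    Pr p k (λ s → θ ≤ᴿ f s) ≤ᴿ θ
  markov {p} {θ} bias k {f} 0<θ 0≤f h = *-cancelˡ 0<θ (
    θ *ᴿ Pr p k (λ s → θ ≤ᴿ f s)                    ≈⟨ avg-* bias k θ _ ⟨
    avg p k (λ s → θ *ᴿ ind (θ ≤ᴿ f s))             ≲⟨ avg-mono bias k (λ s _ → pointwise s) ⟩
    avg p k f                                       ≲⟨ h ⟩
    θ *ᴿ θ                                          ■)
    where
    pointwise : ∀ s → θ *ᴿ ind (θ ≤ᴿ f s) ≤ᴿ f s
    pointwise s with em {θ ≤ᴿ f s}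
    ... | yes le = ≤-trans (proj₁ (*-identityʳ θ)) le
    ... | no _   = ≤-trans (proj₁ (*-zeroʳ θ)) (0≤f s)

  select : ℕ → Pred (List Bool) 0ℓ → List (List Bool)
  select zero P with em {P []}
  ... | yes _ = [] ∷ []
  ... | no _  = []
  select (suc k) P = map (true ∷_) (select k (P ∘ (true ∷_))) ++ map (false ∷_) (select k (P ∘ (false ∷_)))

  ∈-select : ∀ (P : Pred (List Bool) 0ℓ) s → P s → s ∈ select (length s) P
  ∈-select P [] h with em {P []}
  ... | yes _ = here refl
  ... | no ¬h = contradiction h ¬h
  ∈-select P (true ∷ s)  h = ∈.∈-++⁺ˡ (∈.∈-map⁺ (true ∷_) (∈-select (P ∘ (true ∷_)) s h))
  ∈-select P (false ∷ s) h = ∈.∈-++⁺ʳ (map (true ∷_) (select (length s) (P ∘ (true ∷_)))) (∈.∈-map⁺ (false ∷_) (∈-select (P ∘ (false ∷_)) s h))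

  ∈-select⁻ : ∀ k (P : Pred (List Bool) 0ℓ) {s} → s ∈ select k P → length s ≡ k × P s
  ∈-select⁻ zero P s∈ with em {P []}
  ∈-select⁻ zero P (here refl) | yes h = refl , h
  ∈-select⁻ (suc k) P s∈ with ∈.∈-++⁻ (map (true ∷_) (select k (P ∘ (true ∷_)))) s∈
  ... | inj₁ h with ∈.∈-map⁻ (true ∷_) h
  ... | t , t∈ , refl = let (eq , h) = ∈-select⁻ k (P ∘ (true ∷_)) t∈ in cong suc eq , h
  ∈-select⁻ (suc k) P s∈ | inj₂ h with ∈.∈-map⁻ (false ∷_) h
  ... | t , t∈ , refl = let (eq , h) = ∈-select⁻ k (P ∘ (false ∷_)) t∈ in cong suc eq , h

  listWeight-map-true : ∀ p l → listWeight p (map (true ∷_) l) ≈ᴿ p 0 *ᴿ listWeight (p ∘ suc) l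
  listWeight-map-true p []      = ≈-sym (*-zeroʳ _)
  listWeight-map-true p (s ∷ l) = ≈-trans (+-cong ≈-refl (listWeight-map-true p l)) (≈-sym (*-distribˡ _ _ _))

  listWeight-map-false : ∀ p l → listWeight p (map (false ∷_) l) ≈ᴿ (1ᴿ -ᴿ p 0) *ᴿ listWeight (p ∘ suc) l
  listWeight-map-false p []      = ≈-sym (*-zeroʳ _)
  listWeight-map-false p (s ∷ l) = ≈-trans (+-cong ≈-refl (listWeight-map-false p l)) (≈-sym (*-distribˡ _ _ _))

  listWeight-select : ∀ {p} → Bias p → ∀ k (P : Pred (List Bool) 0ℓ) → listWeight p (select k P) ≤ᴿ Pr p k P
  listWeight-select bias zero P with em {P []}
  ... | yes _ = proj₁ (+-identityʳ _)
  ... | no _  = ≤-refl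
  listWeight-select {p} bias (suc k) P = ≤-trans
    (proj₁ (≈-trans (listWeight-++ p (map (true ∷_) (select k (P ∘ (true ∷_)))) _)
      (+-cong (listWeight-map-true p (select k (P ∘ (true ∷_)))) (listWeight-map-false p (select k (P ∘ (false ∷_)))))))
    (+-mono (*-monoʳ (0≤p bias 0) (listWeight-select (bias ∘ suc) k (P ∘ (true ∷_))))
            (*-monoʳ (0≤1-p bias 0) (listWeight-select (bias ∘ suc) k (P ∘ (false ∷_)))))

  -- The strings of length `m + k` whose last `k` digits satisfy `R` form the cover; averaging over
  -- the first `m` digits does not change the probability of `R`.
  cover-block : ∀ {p c} → Bias p → ∀ m k (R : Pred (List Bool) 0ℓ) → Pr (shift m p) k R ≤ᴿ c →
    CoverBound p (λ x → R (applyUpTo (shift m x) k)) c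
  cover-block {p} {c} bias m k R h = cover-mono covers bound (cover-list bias (select (m ℕ.+ k) (R ∘ drop m)))
    where
    drop-length-++ : ∀ (r : List Bool) {s} → drop (length r) (r ++ s) ≡ s
    drop-length-++ []      = refl
    drop-length-++ (_ ∷ r) = drop-length-++ r
    covers : ∀ x → R (applyUpTo (shift m x) k) → x ∈⋃ select (m ℕ.+ k) (R ∘ drop m)
    covers x Rx = lose {P = λ s → ⟦ just s ⟧ x}
      (subst (λ n → applyUpTo x (m ℕ.+ k) ∈ select n (R ∘ drop m)) (List.length-applyUpTo x (m ℕ.+ k))
        (∈-select (R ∘ drop m) (applyUpTo x (m ℕ.+ k)) (subst R (sym
          (trans (cong₂ drop (sym (List.length-applyUpTo x m)) (applyUpTo-+ x m k)) (drop-length-++ (applyUpTo x m)))) Rx)))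
      (cong (applyUpTo x) (List.length-applyUpTo x (m ℕ.+ k)))
    bound : listWeight p (select (m ℕ.+ k) (R ∘ drop m)) ≤ᴿ c
    bound =
      listWeight p (select (m ℕ.+ k) (R ∘ drop m))
        ≲⟨ listWeight-select bias (m ℕ.+ k) (R ∘ drop m) ⟩
      Pr p (m ℕ.+ k) (R ∘ drop m)                                                ≈⟨ avg-++ bias m k _ ⟩
      avg p m (λ r → avg (shift m p) k (λ s → ind (R (drop m (r ++ s)))))
        ≲⟨ avg-mono bias m (λ { r refl → Pr-mono (bias ∘ (length r ℕ.+_)) k (λ s → subst R (drop-length-++ r)) }) ⟩
      avg p m (λ _ → Pr (shift m p) k R)                                         ≈⟨ avg-const bias m _ ⟩
      Pr (shift m p) k R                                                         ≲⟨ h ⟩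
      c                                                                          ■

-- Blocks of integers

Separated : (m k : ℕ → ℕ) → Set
Separated m k = ∀ l → m l ℕ.+ k l ℕ.≤ m (suc l)

module Blocks {m k : ℕ → ℕ} (sep : Separated m k) where

  block-≤ : ∀ {l l′} → l ℕ.< l′ → m l ℕ.+ k l ℕ.≤ m l′
  block-≤ {l} {suc l′} l<1+l′ with ℕ.m<1+n⇒m<n∨m≡n l<1+l′
  ... | inj₁ l<l′ = ℕ.≤-trans (block-≤ l<l′) (ℕ.≤-trans (ℕ.m≤m+n (m l′) (k l′)) (sep l′))
  ... | inj₂ refl = sep l

  block-unique : ∀ {l l′ i i′} → i ℕ.< k l → i′ ℕ.< k l′ → m l ℕ.+ i ≡ m l′ ℕ.+ i′ → l ≡ l′
  block-unique {l} {l′} i<k i′<k eq with ℕ.<-cmp l l′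
  ... | tri≈ _ l≡l′ _ = l≡l′
  ... | tri< l<l′ _ _ = contradiction eq (ℕ.<⇒≢ (ℕ.<-≤-trans (ℕ.+-monoʳ-< (m l) i<k) (ℕ.≤-trans (block-≤ l<l′) (ℕ.m≤m+n (m l′) _))))
  ... | tri> _ _ l′<l = contradiction (sym eq) (ℕ.<⇒≢ (ℕ.<-≤-trans (ℕ.+-monoʳ-< (m l′) i′<k) (ℕ.≤-trans (block-≤ l′<l) (ℕ.m≤m+n (m l) _))))

  -- `G` is `Z l` on block `l` and `X` elsewhere. By `block-unique`, the block that excluded middle
  -- supplies for an index is the expected one.
  glue : ExcludedMiddle 0ℓ → (X : 2^ω) (Z : ℕ → 2^ω) → ∃[ G ]
    (∀ l i → i ℕ.< k l → G (m l ℕ.+ i) ≡ Z l (m l ℕ.+ i)) ×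
    (∀ a → G a ≡ X a ⊎ ∃[ l ] ∃[ i ] i ℕ.< k l × a ≡ m l ℕ.+ i × G a ≡ Z l a)
  glue em X Z = G , inside , outside
    where
    InBlock : ℕ → Set
    InBlock a = ∃[ l ] ∃[ i ] i ℕ.< k l × a ≡ m l ℕ.+ i
    G : 2^ω
    G a with em {InBlock a}
    ... | yes (l , _) = Z l a
    ... | no _        = X a
    inside : ∀ l i → i ℕ.< k l → G (m l ℕ.+ i) ≡ Z l (m l ℕ.+ i)
    inside l i i<k with em {InBlock (m l ℕ.+ i)}
    ... | yes (l′ , i′ , i′<k , eq) = cong (λ j → Z j (m l ℕ.+ i)) (block-unique i′<k i<k (sym eq))
    ... | no none = contradiction (l , i , i<k , refl) none
    outside : ∀ a → G a ≡ X a ⊎ ∃[ l ] ∃[ i ] i ℕ.< k l × a ≡ m l ℕ.+ i × G a ≡ Z l a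
    outside a with em {InBlock a}
    ... | yes (l , i , i<k , eq) = inj₂ (l , i , i<k , eq , refl)
    ... | no _ = inj₁ refl

applyUpTo-cong : ∀ {A : Set} {f g : ℕ → A} k → (∀ i → i ℕ.< k → f i ≡ g i) → applyUpTo f k ≡ applyUpTo g k
applyUpTo-cong zero    h = refl
applyUpTo-cong (suc k) h = cong₂ _∷_ (h 0 (ℕ.s≤s ℕ.z≤n)) (applyUpTo-cong k (λ i i<k → h (suc i) (ℕ.s≤s i<k)))

support : (ℕ → ℕ) → List Bool → FinSet
support f []          = []
support f (true ∷ s)  = f 0 ∷ support (f ∘ suc) s
support f (false ∷ s) = support (f ∘ suc) s

∈-support : ∀ {a} f s → a ∈ support f s → ∃[ i ] i ℕ.< length s × a ≡ f i
∈-support f (true ∷ s) (here eq) = 0 , ℕ.s≤s ℕ.z≤n , eq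
∈-support f (true ∷ s) (there h) = let (i , i< , eq) = ∈-support (f ∘ suc) s h in suc i , ℕ.s≤s i< , eq
∈-support f (false ∷ s) h        = let (i , i< , eq) = ∈-support (f ∘ suc) s h in suc i , ℕ.s≤s i< , eq

support-self : ∀ X f k → All (_∈ω X) (support f (applyUpTo (X ∘ f) k))
support-self X f zero = []
support-self X f (suc k) with X (f 0) in eq
... | true  = eq ∷ support-self X (f ∘ suc) k
... | false = support-self X (f ∘ suc) k

support-⊆ : ∀ X {Y} f k → All (_∈ω Y) (support f (applyUpTo (X ∘ f) k)) → ∀ i → i ℕ.< k → f i ∈ω X → f i ∈ω Y
support-⊆ X f (suc k) h i i<k i∈X with X (f 0) in eq
support-⊆ X f (suc k) (h ∷ _) zero    _           _   | true  = h
support-⊆ X f (suc k) (_ ∷ h) (suc i) (ℕ.s≤s i<k) i∈X | true  = support-⊆ X (f ∘ suc) k h i i<k i∈X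
support-⊆ X f (suc k) h       zero    _           i∈X | false = contradiction (trans (sym eq) i∈X) λ ()
support-⊆ X f (suc k) h       (suc i) (ℕ.s≤s i<k) i∈X | false = support-⊆ X (f ∘ suc) k h i i<k i∈X

block : (m k : ℕ → ℕ) → ℕ → 2^ω → List Bool
block m k l x = applyUpTo (shift (m l) x) (k l)

-- From single-block events to families of finite sets

module FromNull (em : ExcludedMiddle 0ℓ) {p : ℕ → ℝ} (bias : Bias p) {F : Pred 2^ω 0ℓ} (isF : IsFilter F) where
  open Classical em
  open Indicator em
  open Measure em bias

  -- Suppose a member `X` of `F` meets no family from `N` on. On each of these blocks it can be
  -- enlarged so as to violate `R l`; gluing the enlargements gives a larger set, hence a member of
  -- `F`, that never satisfies `R l` from `N` on.
  small-blocks⇒witness : ∀ m k → Separated m k → (R : ℕ → Pred (List Bool) 0ℓ) (c : ℕ → ℝ) →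
    (∀ l → Pr (shift (m l) p) (k l) (R l) ≤ᴿ c l) → SumFinite c →
    (∀ X → F X → ∀ N → ∃[ l ] N ℕ.≤ l × R l (block m k l X)) →
    ∃[ 𝒜 ] IsWitness p F 𝒜
  small-blocks⇒witness m k sep R c PrR≤c (b , c≤b) R-hits = 𝒜 , record
    { disjoint = disjoint
    ; summable = (λ n → proj₁ (outer-measure (Meets (𝒜 n)))) , (λ n → proj₂ (outer-measure (Meets (𝒜 n))))
               -- The sum of the measures starts at index 1, so the nonnegative `c 0` is added to
               -- obtain a partial sum of `c`.
               , b , λ N → ≤-trans (∑-mono (μ𝒜≤c ∘ suc) N)
                   (≤-trans (x≤y+x (0≤c 0)) (≤-trans (proj₂ (∑-head c N)) (c≤b (suc N))))
    ; hits = hits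
    }
    where
    open Blocks {m} {k} sep
    -- The sets forcing R l generate the upward closed interior of R l.
    Forces : ℕ → Pred FinSet 0ℓ
    Forces l a = ∀ x → All (_∈ω x) a → R l (block m k l x)
    supp : ℕ → List Bool → FinSet
    supp l = support (m l ℕ.+_)
    𝒜 : ℕ → FinFamily
    𝒜 l = map (supp l) (select (k l) (Forces l ∘ supp l))
    𝒜-block : ∀ {l a} → a ∈ ⋃ (𝒜 l) → ∃[ i ] i ℕ.< k l × a ≡ m l ℕ.+ i
    𝒜-block {l} {a} a∈ with ∈.∈-concat⁻′ (𝒜 l) a∈
    ... | A , a∈A , A∈ with ∈.∈-map⁻ (supp l) A∈
    ... | s , s∈ , refl = let (len , _)     = ∈-select⁻ (k l) (Forces l ∘ supp l) s∈
                              (i , i< , eq) = ∈-support (m l ℕ.+_) s a∈A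
                          in i , subst (i ℕ.<_) len i< , eq
    disjoint : ∀ n n′ → n ≢ n′ → ∀ {a} → ¬ (a ∈ ⋃ (𝒜 n) × a ∈ ⋃ (𝒜 n′))
    disjoint n n′ n≢n′ (h , h′) =
      let (i , i< , eq)    = 𝒜-block h
          (i′ , i′< , eq′) = 𝒜-block h′
      in n≢n′ (block-unique i< i′< (trans (sym eq) eq′))
    meets⇒R : ∀ l x → Meets (𝒜 l) x → R l (block m k l x)
    meets⇒R l x meets with find meets
    ... | A , A∈ , A⊆x with ∈.∈-map⁻ (supp l) A∈
    ... | s , s∈ , refl = proj₂ (∈-select⁻ (k l) (Forces l ∘ supp l) s∈) x A⊆x
    cover : ∀ l → CoverBound p (Meets (𝒜 l)) (c l)
    cover l = cover-mono (meets⇒R l) ≤-refl (cover-block bias (m l) (k l) (R l) (PrR≤c l))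
    μ𝒜≤c : ∀ l → proj₁ (outer-measure (Meets (𝒜 l))) ≤ᴿ c l
    μ𝒜≤c l = proj₁ (proj₂ (outer-measure (Meets (𝒜 l)))) (c l) (cover l)
    0≤c : ∀ l → 0ᴿ ≤ᴿ c l
    0≤c l = proj₂ (proj₂ (cover l)) 0
    -- Since `X` meets nothing in `𝒜 l`, its own trace on the block does not force `R l`; a
    -- counterexample to the forcing is the required `x`.
    escape : ∀ l X → ¬ Meets (𝒜 l) X →
      ∃[ x ] (∀ i → i ℕ.< k l → m l ℕ.+ i ∈ω X → m l ℕ.+ i ∈ω x) × ¬ R l (block m k l x)
    escape l X ¬meets =
      let s         = block m k l X
          (x , ¬h)  = ¬∀⇒∃¬ λ forces → ¬meets (lose {P = All (_∈ω X)}
                        (∈.∈-map⁺ (supp l) (subst (λ n → s ∈ select n (Forces l ∘ supp l)) (List.length-applyUpTo _ (k l))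
                          (∈-select (Forces l ∘ supp l) s forces)))
                        (support-self X (m l ℕ.+_) (k l)))
          (⊆x , ¬R) = ¬∀⇒∃¬ ¬h
      in x , support-⊆ X (m l ℕ.+_) (k l) ⊆x , ¬R
    hits : ∀ X → F X → ∀ N → ∃[ n ] N ℕ.≤ n × Meets (𝒜 n) X
    hits X X∈F N = ¬¬-elim λ none →
      let Z : ℕ → 2^ω
          Z l = proj₁ (choice none l)
          (G , inside , outside) = glue em X Z
          X⊆G : X ⊆ω G
          X⊆G a a∈X = [ (λ eq → trans eq a∈X)
                               , (λ (l , i , i<k , a≡ , eq) → trans eq (subst (_∈ω Z l) (sym a≡)
                                   (proj₁ (proj₂ (choice none l)) i i<k (subst (_∈ω X) a≡ a∈X)))) ]′ (outside a)
          (l , N≤l , Rl) = R-hits G (IsFilter.upward isF X⊆G X∈F) N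
      in proj₂ (proj₂ (choice none l)) N≤l (subst (R l) (applyUpTo-cong (k l) (inside l)) Rl)
      where
      choice : ¬ (∃[ n ] N ℕ.≤ n × Meets (𝒜 n) X) → ∀ l →
        ∃[ x ] (∀ i → i ℕ.< k l → m l ℕ.+ i ∈ω X → m l ℕ.+ i ∈ω x) × (N ℕ.≤ l → ¬ R l (block m k l x))
      choice none l with N ℕ.≤? l
      -- Nothing is required before `N`, so `X` itself is kept on these blocks.
      ... | no N≰l  = X , (λ _ _ h → h) , λ N≤l → contradiction N≤l N≰l
      ... | yes N≤l = let (x , ⊆x , ¬R) = escape l X (λ meets → none (l , N≤l , meets)) in x , ⊆x , λ _ → ¬R

  -- The sequence 2^-(j+1), whose partial sums are at most 1.
  θ : ℕ → ℝ
  θ j = fromℚ (geometric 1ℚ (suc j))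

  0<θ : ∀ j → 0ᴿ <ᴿ θ j
  0<θ j = fromℚ-pos (geometric-pos (ℚ.positive⁻¹ 1ℚ) (suc j))

  θ-anti : ∀ {i j} → i ℕ.≤ j → θ j ≤ᴿ θ i
  θ-anti {i} i≤j with ℕ.m≤n⇒∃[o]m+o≡n i≤j
  ... | o , refl = fromℚ-mono (go o)
    where
    go : ∀ o → geometric 1ℚ (suc (i ℕ.+ o)) ℚ.≤ geometric 1ℚ (suc i)
    go zero rewrite ℕ.+-identityʳ i = ℚ.≤-refl
    go (suc o) rewrite ℕ.+-suc i o = ℚ.≤-trans (half≤ (ℚ.<⇒≤ (geometric-pos (ℚ.positive⁻¹ 1ℚ) (suc (i ℕ.+ o))))) (go o)
      where
      half≤ : ∀ {q} → 0ℚ ℚ.≤ q → q ℚ.* ½ ℚ.≤ q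
      half≤ {q} 0≤q = subst (q ℚ.* ½ ℚ.≤_) (ℚ.*-identityʳ q) (ℚ.*-monoˡ-≤-nonNeg q {{ℚ.nonNegative 0≤q}} {½} {1ℚ} (ℚ.<⇒≤ (ℚ.≰⇒> λ { (ℚ.*≤* (ℤ.+≤+ (ℕ.s≤s ()))) })))

  ∑θ≤1 : ∀ N → ∑ θ N ≤ᴿ 1ᴿ
  ∑θ≤1 = ∑-geometric (ℚ.positive⁻¹ 1ℚ)

  -- From events about two neighbouring blocks to single-block events

  module TwoBlocks (n k : ℕ → ℕ) (n-suc : ∀ j → n (suc j) ≡ n j ℕ.+ k j)
    (J : ℕ → List Bool → List Bool → Set)
    (PrJ : ∀ j → avg (shift (n j) p) (k j) (λ s → Pr (shift (n (suc j)) p) (k (suc j)) (J j s)) ≤ᴿ θ j *ᴿ θ j)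
    (J-hits : ∀ X → F X → ∀ N → ∃[ j ] N ℕ.≤ j × J j (block n k j X) (block n k (suc j) X)) where

    sep : Separated n k
    sep j = ℕ.≤-reflexive (sym (n-suc j))

    open Blocks {n} {k} sep

    biasₙ : ∀ j → Bias (shift (n j) p)
    biasₙ j = bias ∘ (n j ℕ.+_)

    -- Strings on one block along which the section of `J j` is likely. As `J j` has probability at
    -- most `θ j * θ j`, Markov's inequality gives such strings probability at most `θ j`.
    HeavyLeft HeavyRight : ℕ → Pred (List Bool) 0ℓ
    HeavyLeft  j s = θ j ≤ᴿ Pr (shift (n (suc j)) p) (k (suc j)) (J j s)
    HeavyRight j t = θ j ≤ᴿ Pr (shift (n j) p) (k j) (λ s → J j s t)

    Pr-HeavyLeft : ∀ j → Pr (shift (n j) p) (k j) (HeavyLeft j) ≤ᴿ θ j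
    Pr-HeavyLeft j = markov (biasₙ j) (k j) (0<θ j) (λ s → 0≤Pr (biasₙ (suc j)) (k (suc j)) {J j s}) (PrJ j)

    Pr-HeavyRight : ∀ j → Pr (shift (n (suc j)) p) (k (suc j)) (HeavyRight j) ≤ᴿ θ j
    Pr-HeavyRight j = markov (biasₙ (suc j)) (k (suc j)) (0<θ j) (λ t → 0≤Pr (biasₙ j) (k j) {λ s → J j s t})
      (≤-trans (proj₁ (avg-swap (biasₙ (suc j)) (biasₙ j) (k (suc j)) (k j) (λ t s → ind (J j s t)))) (PrJ j))

    -- Gathers by block what `HeavyAt` gathers by `J j`: each block is the left one of its own event
    -- and the right one of the preceding event, except that block 0 has no predecessor.
    Heavy : ℕ → Pred (List Bool) 0ℓ
    Heavy zero    s = HeavyLeft 0 s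
    Heavy (suc j) s = HeavyLeft (suc j) s ⊎ HeavyRight j s

    θ⁺ : ℕ → ℝ
    θ⁺ zero    = 0ᴿ
    θ⁺ (suc j) = θ j

    ∑θ⁺≤1 : ∀ N → ∑ θ⁺ N ≤ᴿ 1ᴿ
    ∑θ⁺≤1 zero    = 0≤1
    ∑θ⁺≤1 (suc N) = ≤-trans (proj₁ (∑-head θ⁺ N)) (≤-trans (proj₁ (+-identityˡ _)) (∑θ≤1 N))

    Pr-Heavy : ∀ j → Pr (shift (n j) p) (k j) (Heavy j) ≤ᴿ θ j +ᴿ θ⁺ j
    Pr-Heavy zero    = ≤-trans (Pr-HeavyLeft 0) (x≤x+y ≤-refl)
    Pr-Heavy (suc j) = ≤-trans (Pr-∪ (biasₙ (suc j)) (k (suc j)) (λ _ h → h)) (+-mono (Pr-HeavyLeft (suc j)) (Pr-HeavyRight j))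

    HeavyAt : ℕ → Pred 2^ω 0ℓ
    HeavyAt j X = HeavyLeft j (block n k j X) ⊎ HeavyRight j (block n k (suc j) X)

    heavy⇒witness : (∀ X → F X → ∀ N → ∃[ j ] N ℕ.≤ j × HeavyAt j X) → ∃[ 𝒜 ] IsWitness p F 𝒜
    heavy⇒witness heavy = small-blocks⇒witness n k sep Heavy (λ j → θ j +ᴿ θ⁺ j) Pr-Heavy
      (1ᴿ +ᴿ 1ᴿ , λ N → ≤-trans (proj₁ (∑-+ θ θ⁺ N)) (+-mono (∑θ≤1 N) (∑θ⁺≤1 N)))
      λ X X∈F N → let (j , N≤j , h) = heavy X X∈F N in [ left X j N≤j , (λ r → suc j , ℕ.m≤n⇒m≤1+n N≤j , inj₂ r) ]′ h
      where
      left : ∀ X {N} j → N ℕ.≤ j → HeavyLeft j (block n k j X) → ∃[ l ] N ℕ.≤ l × Heavy l (block n k l X)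
      left X zero    N≤j h = zero , N≤j , h
      left X (suc j) N≤j h = suc j , N≤j , inj₁ h

    double : ℕ → ℕ
    double zero    = zero
    double (suc h) = suc (suc (double h))

    parity : ∀ j → (∃[ h ] j ≡ double h) ⊎ (∃[ h ] j ≡ suc (double h))
    parity zero = inj₁ (0 , refl)
    parity (suc j) with parity j
    ... | inj₁ (h , refl) = inj₂ (h , refl)
    ... | inj₂ (h , refl) = inj₁ (suc h , refl)

    even? : ℕ → Bool
    even? zero    = true
    even? (suc j) = not (even? j)

    even?-double : ∀ h → even? (double h) ≡ true
    even?-double zero    = refl
    even?-double (suc h) rewrite even?-double h = refl

    n≤double : ∀ h → h ℕ.≤ double h
    n≤double zero    = ℕ.z≤n
    n≤double (suc h) = ℕ.s≤s (ℕ.m≤n⇒m≤1+n (n≤double h))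

    double-cancel-≤ : ∀ {g h} → double g ℕ.≤ suc (double h) → g ℕ.≤ h
    double-cancel-≤ {zero}          le = ℕ.z≤n
    double-cancel-≤ {suc g} {zero}  (ℕ.s≤s ())
    double-cancel-≤ {suc g} {suc h} (ℕ.s≤s (ℕ.s≤s le)) = ℕ.s≤s (double-cancel-≤ le)

    n-mono : ∀ {i j} → i ℕ.≤ j → n i ℕ.≤ n j
    n-mono i≤j with ℕ.m≤n⇒m<n∨m≡n i≤j
    ... | inj₁ i<j  = ℕ.≤-trans (ℕ.m≤m+n _ _) (block-≤ i<j)
    ... | inj₂ refl = ℕ.≤-refl

    -- If X eventually avoids the heavy strings, then every Y in F hits the
    -- sections of J along X at infinitely many even blocks: otherwise Y on
    -- the even blocks and X on the odd ones contains X ∩ Y and avoids J.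
    light⇒witness : ∀ X i₀ → F X → (∀ j → i₀ ℕ.≤ j → ¬ HeavyAt j X) → ∃[ 𝒜 ] IsWitness p F 𝒜
    light⇒witness X i₀ X∈F light = small-blocks⇒witness (n ∘ suc ∘ odd) (k ∘ suc ∘ odd) sep′ R (λ l → θ l +ᴿ θ l) PrR
      (1ᴿ +ᴿ 1ᴿ , λ N → ≤-trans (proj₁ (∑-+ θ θ N)) (+-mono (∑θ≤1 N) (∑θ≤1 N)))
      R-hits
      where
      -- Odd indices beyond `i₀`, where `X` is light.
      odd : ℕ → ℕ
      odd l = suc (double (i₀ ℕ.+ l))
      X[_] : ℕ → List Bool
      X[ j ] = block n k j X
      -- Both neighbours of the even block `suc (odd l)` are odd and filled by `X`, so fixing them
      -- leaves events about this block alone.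
      R : ℕ → Pred (List Bool) 0ℓ
      R l z = J (odd l) X[ odd l ] z ⊎ J (suc (odd l)) z X[ suc (suc (odd l)) ]
      sep′ : Separated (n ∘ suc ∘ odd) (k ∘ suc ∘ odd)
      sep′ l rewrite ℕ.+-suc i₀ l = ℕ.≤-trans (sep (suc (odd l))) (n-mono (ℕ.n≤1+n _))
      i₀≤odd : ∀ l → i₀ ℕ.≤ odd l
      i₀≤odd l = ℕ.m≤n⇒m≤1+n (ℕ.≤-trans (ℕ.m≤m+n i₀ l) (n≤double (i₀ ℕ.+ l)))
      l≤odd : ∀ l → l ℕ.≤ odd l
      l≤odd l = ℕ.m≤n⇒m≤1+n (ℕ.≤-trans (ℕ.m≤n+m l i₀) (n≤double (i₀ ℕ.+ l)))
      PrR : ∀ l → Pr (shift (n (suc (odd l))) p) (k (suc (odd l))) (R l) ≤ᴿ θ l +ᴿ θ l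
      PrR l = ≤-trans (Pr-∪ (biasₙ (suc (odd l))) (k (suc (odd l))) (λ _ h → h)) (+-mono
        -- Lightness of `X` bounds each section by `θ` at its own index, and `θ` decreases.
        (≤-trans (<⇒≤ (≰⇒> (light (odd l) (i₀≤odd l) ∘ inj₁))) (θ-anti (l≤odd l)))
        (≤-trans (<⇒≤ (≰⇒> (light (suc (odd l)) (ℕ.m≤n⇒m≤1+n (i₀≤odd l)) ∘ inj₂))) (θ-anti (ℕ.m≤n⇒m≤1+n (l≤odd l)))))
      R-hits : ∀ Y → F Y → ∀ N → ∃[ l ] N ℕ.≤ l × R l (block (n ∘ suc ∘ odd) (k ∘ suc ∘ odd) l Y)
      R-hits Y Y∈F N with glue em X (λ j → if even? j then Y else X)
      ... | G , inside , outside = found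
        where
        Z : ℕ → 2^ω
        Z j = if even? j then Y else X
        X∩Y⊆Z : ∀ j a → a ∈ω X ∩ω Y → a ∈ω Z j
        X∩Y⊆Z j a h with X a in eqX | Y a in eqY | even? j
        ... | true | true | true  = eqY
        ... | true | true | false = eqX
        X∩Y⊆G : (X ∩ω Y) ⊆ω G
        X∩Y⊆G a h with outside a
        ... | inj₂ (j , _ , _ , _ , eq) = trans eq (X∩Y⊆Z j a h)
        -- Outside all blocks `G` equals `X`, which is also `Z 1`.
        ... | inj₁ eq = trans eq (X∩Y⊆Z 1 a h)
        G-block : ∀ j → block n k j G ≡ block n k j (Z j)
        G-block j = applyUpTo-cong (k j) (inside j)
        G-even : ∀ h → block n k (double h) G ≡ block n k (double h) Y
        G-even h = trans (G-block (double h)) (cong (λ b → block n k (double h) (if b then Y else X)) (even?-double h))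
        G-odd : ∀ h → block n k (suc (double h)) G ≡ block n k (suc (double h)) X
        G-odd h = trans (G-block (suc (double h))) (cong (λ b → block n k (suc (double h)) (if not b then Y else X)) (even?-double h))
        lower : ∀ {h} → i₀ ℕ.+ N ℕ.≤ h → ∃[ l ] h ≡ i₀ ℕ.+ l × N ℕ.≤ l
        lower le = let (o , eq) = ℕ.m≤n⇒∃[o]m+o≡n le in N ℕ.+ o , trans (sym eq) (ℕ.+-assoc i₀ N o) , ℕ.m≤m+n N o
        found : ∃[ l ] N ℕ.≤ l × R l (block n k (suc (odd l)) Y)
        -- An odd `j` has its even block on the right, an even `j` on the left. In the second case
        -- `j = double (suc h)` with `h = i₀ + l`, hence the extra `suc` in the threshold.
        found with J-hits G (IsFilter.upward isF X∩Y⊆G (IsFilter.∩-closed isF X∈F Y∈F)) (double (suc (i₀ ℕ.+ N)))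
        ... | j , le , Jj with parity j
        ... | inj₂ (h , refl) with lower (ℕ.≤-trans (ℕ.n≤1+n _) (double-cancel-≤ le))
        ... | l , refl , N≤l = l , N≤l , inj₁ (subst₂ (J (odd l)) (G-odd (i₀ ℕ.+ l)) (G-even (suc (i₀ ℕ.+ l))) Jj)
        found | j , le , Jj | inj₁ (zero , refl) = contradiction le λ ()
        found | j , le , Jj | inj₁ (suc h , refl) with lower (ℕ.≤-pred (double-cancel-≤ (ℕ.m≤n⇒m≤1+n le)))
        ... | l , refl , N≤l = l , N≤l , inj₂ (subst₂ (J (suc (odd l))) (G-even (suc (i₀ ℕ.+ l))) (G-odd (suc (i₀ ℕ.+ l))) Jj)

    witness : ∃[ 𝒜 ] IsWitness p F 𝒜
    witness with em {∃[ X ] F X × (∃[ i₀ ] ∀ j → i₀ ℕ.≤ j → ¬ HeavyAt j X)}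
    ... | yes (X , X∈F , i₀ , light) = light⇒witness X i₀ X∈F light
    ... | no none = heavy⇒witness λ X X∈F N → ¬¬-elim λ ¬heavy →
      none (X , X∈F , N , λ j N≤j h → ¬heavy (j , N≤j , h))

-- Cutting the integers into blocks along a sequence of finite lists

maxLength : List (List Bool) → ℕ
maxLength []      = 0
maxLength (s ∷ l) = length s ℕ.⊔ maxLength l

∈⋃⇒Extends : ∀ {x n} l → maxLength l ℕ.≤ n → x ∈⋃ l → Any (Extends (applyUpTo x n)) l
∈⋃⇒Extends (s ∷ l) le (here h)  = here (∈⇒Extends s (ℕ.≤-trans (ℕ.m≤m⊔n _ _) le) h)
∈⋃⇒Extends (s ∷ l) le (there h) = there (∈⋃⇒Extends l (ℕ.≤-trans (ℕ.m≤n⊔m (length s) _) le) h)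

maxLengthBelow : (ℕ → List (List Bool)) → ℕ → ℕ
maxLengthBelow L zero    = 0
maxLengthBelow L (suc N) = maxLengthBelow L N ℕ.⊔ maxLength (L N)

maxLength≤ : ∀ L {D N} → D ℕ.< N → maxLength (L D) ℕ.≤ maxLengthBelow L N
maxLength≤ L {D} {suc N} D<1+N with ℕ.m<1+n⇒m<n∨m≡n D<1+N
... | inj₁ D<N  = ℕ.≤-trans (maxLength≤ L D<N) (ℕ.m≤m⊔n _ _)
... | inj₂ refl = ℕ.m≤n⊔m (maxLengthBelow L N) _

module BlockSequence (L : ℕ → List (List Bool)) (start : ℕ → ℕ → ℕ) (≤start : ∀ j m → j ℕ.≤ start j m) where

  -- Block `j` has length `k j` and starts at `n j`; batch `j` consists of the lists from level
  -- `N j` up to `N (suc j)`. Its strings are no longer than `k (suc j)`, so they end before block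
  -- `suc j` does. The level `N j` may depend on `n j` because the tail must be small compared with
  -- `leastWeight p (n j)`.
  n k N : ℕ → ℕ
  n zero    = 0
  n (suc j) = n j ℕ.+ maxLengthBelow L (start j (n j))
  k j = maxLengthBelow L (start j (n j))
  N j = start j (n j)

  Q : ℕ → Pred (List Bool) 0ℓ
  Q j s = ∃[ i ] i ℕ.< N (suc j) ℕ.∸ N j × Any (Extends s) (L (N j ℕ.+ i))

  -- Quantifying over the digits `r` before block `j` makes the event depend on two blocks only.
  J : ℕ → List Bool → List Bool → Set
  J j s t = ∃[ r ] length r ≡ n j × Q j ((r ++ s) ++ t)

  -- As `j ≤ N j`, the levels pass `D` at the latest at index `I + suc D`; `search` finds a
  -- crossing.
  locate : ∀ I D → N I ℕ.≤ D → ∃[ j ] I ℕ.≤ j × N j ℕ.≤ D × D ℕ.< N (suc j)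
  locate I D NI≤D with search {λ o → N (I ℕ.+ o) ℕ.≤ D} (λ o → N (I ℕ.+ o) ℕ.≤? D)
    (subst (λ j → N j ℕ.≤ D) (sym (ℕ.+-identityʳ I)) NI≤D) (suc D)
    (ℕ.<⇒≱ (ℕ.≤-trans (ℕ.m≤n+m (suc D) I) (≤start (I ℕ.+ suc D) _)))
  ... | o , lower , upper = I ℕ.+ o , ℕ.m≤m+n I o , lower , ℕ.≰⇒> (upper ∘ subst (λ i → N i ℕ.≤ D) (sym (ℕ.+-suc I o)))

  J-block : ∀ j i X → N j ℕ.+ i ℕ.< N (suc j) → X ∈⋃ L (N j ℕ.+ i) → J j (block n k j X) (block n k (suc j) X)
  J-block j i X D<N X∈D = applyUpTo X (n j) , List.length-applyUpTo X (n j) , i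
    , ℕ.m+n≤o⇒m≤o∸n (suc i) (subst (ℕ._≤ N (suc j)) (cong suc (ℕ.+-comm (N j) i)) D<N)
    , subst (λ s → Any (Extends s) (L (N j ℕ.+ i)))
        (trans (applyUpTo-+ X (n (suc j)) (k (suc j))) (cong (_++ block n k (suc j) X) (applyUpTo-+ X (n j) (k j))))
        (∈⋃⇒Extends (L (N j ℕ.+ i)) (ℕ.≤-trans (maxLength≤ L D<N) (ℕ.m≤n+m (k (suc j)) (n (suc j)))) X∈D)

  J-hits : ∀ X → (∀ M → ∃[ D ] M ℕ.≤ D × X ∈⋃ L D) → ∀ I → ∃[ j ] I ℕ.≤ j × J j (block n k j X) (block n k (suc j) X)
  J-hits X L-hits I with L-hits (N I)
  ... | D , NI≤D , X∈D with locate I D NI≤D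
  ... | j , I≤j , Nj≤D , D<N with ℕ.m≤n⇒∃[o]m+o≡n Nj≤D
  ... | i , refl = j , I≤j , J-block j i X D<N X∈D

-- Null filters have witnesses

module _ (em : ExcludedMiddle 0ℓ) {p : ℕ → ℝ} (bias : Bias p) {F : Pred 2^ω 0ℓ} (isF : IsFilter F) where
  open Classical em
  open Indicator em
  open FromNull em bias isF

  module _ (L : ℕ → List (List Bool)) (start : ℕ → ℕ → ℕ) (≤start : ∀ j m → j ℕ.≤ start j m)
    (tail : ∀ j m K → ∑ (shift (start j m) (listWeight p ∘ L)) K ≤ᴿ leastWeight p m *ᴿ (θ j *ᴿ θ j)) where

    open BlockSequence L start ≤start

    PrQ : ∀ j → Pr p (n (suc (suc j))) (Q j) ≤ᴿ leastWeight p (n j) *ᴿ (θ j *ᴿ θ j)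
    PrQ j = ≤-trans (Pr-∃< bias (n (suc (suc j))) (λ i → Pr-list bias (n (suc (suc j))) (L (N j ℕ.+ i))) (N (suc j) ℕ.∸ N j))
      (tail j (n j) (N (suc j) ℕ.∸ N j))

    -- If `J j s t` holds, a single prefix `r` already contributes at least `leastWeight p (n j)` to
    -- the probability of `Q j`. Forgetting the prefix thus costs at most the inverse of this
    -- weight, which the choice of `N j` has paid for in advance.
    PrJ : ∀ j → avg (shift (n j) p) (k j) (λ s → Pr (shift (n (suc j)) p) (k (suc j)) (J j s)) ≤ᴿ θ j *ᴿ θ j
    PrJ j = *-cancelˡ (0<leastWeight bias (n j)) (
      w *ᴿ avg pⱼ (k j) (λ s → avg pⱼ₊₁ (k (suc j)) (λ t → ind (J j s t)))
        ≈⟨ avg-* biasⱼ (k j) w _ ⟨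
      avg pⱼ (k j) (λ s → w *ᴿ avg pⱼ₊₁ (k (suc j)) (λ t → ind (J j s t)))
        ≈⟨ avg-cong biasⱼ (k j) (λ s → avg-* biasⱼ₊₁ (k (suc j)) w _) ⟨
      avg pⱼ (k j) (λ s → avg pⱼ₊₁ (k (suc j)) (λ t → w *ᴿ ind (J j s t)))
        ≲⟨ avg-mono biasⱼ (k j) (λ s _ → avg-mono biasⱼ₊₁ (k (suc j)) (λ t _ → forget s t)) ⟩
      avg pⱼ (k j) (λ s → avg pⱼ₊₁ (k (suc j)) (λ t → avg p (n j) (λ r → f r s t)))
        -- Two exchanges move the average over `r` outermost, so that `r`, `s`, `t` can be joined
        -- into one string.
        ≈⟨ avg-cong biasⱼ (k j) (λ s → avg-swap bias biasⱼ₊₁ (n j) (k (suc j)) (λ r t → f r s t)) ⟨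
      avg pⱼ (k j) (λ s → avg p (n j) (λ r → avg pⱼ₊₁ (k (suc j)) (λ t → f r s t)))
        ≈⟨ avg-swap bias biasⱼ (n j) (k j) (λ r s → avg pⱼ₊₁ (k (suc j)) (λ t → f r s t)) ⟨
      avg p (n j) (λ r → avg pⱼ (k j) (λ s → avg pⱼ₊₁ (k (suc j)) (λ t → f r s t)))
        ≈⟨ avg-++ bias (n j) (k j) _ ⟨
      avg p (n (suc j)) (λ u → avg pⱼ₊₁ (k (suc j)) (λ t → ind (Q j (u ++ t))))
        ≈⟨ avg-++ bias (n (suc j)) (k (suc j)) _ ⟨
      Pr p (n (suc (suc j))) (Q j)
        ≲⟨ PrQ j ⟩
      w *ᴿ (θ j *ᴿ θ j) ■)
      where
      w : ℝ
      w = leastWeight p (n j)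
      pⱼ pⱼ₊₁ : ℕ → ℝ
      pⱼ   = shift (n j) p
      pⱼ₊₁ = shift (n (suc j)) p
      biasⱼ : Bias pⱼ
      biasⱼ = bias ∘ (n j ℕ.+_)
      biasⱼ₊₁ : Bias pⱼ₊₁
      biasⱼ₊₁ = bias ∘ (n (suc j) ℕ.+_)
      f : List Bool → List Bool → List Bool → ℝ
      f r s t = ind (Q j ((r ++ s) ++ t))
      forget : ∀ s t → w *ᴿ ind (J j s t) ≤ᴿ avg p (n j) (λ r → f r s t)
      forget s t with em {J j s t}
      ... | no _ = ≤-trans (proj₁ (*-zeroʳ w)) (0≤avg bias (n j) (λ r → 0≤ind _))
      ... | yes (r , len , h) =
        w *ᴿ 1ᴿ            ≲⟨ *-monoʳ (<⇒≤ (0<leastWeight bias (n j))) (1≤ind h) ⟩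
        w *ᴿ f r s t       ≲⟨ subst (λ m → leastWeight p m *ᴿ f r s t ≤ᴿ avg p m (λ r → f r s t)) len
                               (leastWeight*≤avg bias {λ r → f r s t} (λ r → 0≤ind _) r) ⟩
        avg p (n j) (λ r → f r s t) ■

    tails⇒witness : (∀ X → F X → ∀ M → ∃[ D ] M ℕ.≤ D × X ∈⋃ L D) → ∃[ 𝒜 ] IsWitness p F 𝒜
    tails⇒witness L-hits = TwoBlocks.witness n k (λ _ → refl) J PrJ (λ X X∈F → J-hits X (L-hits X X∈F))

  lists⇒witness : (L : ℕ → List (List Bool)) → (∀ N → ∑ (listWeight p ∘ L) N ≤ᴿ 1ᴿ) →
    (∀ X → F X → ∀ N → ∃[ D ] N ℕ.≤ D × X ∈⋃ L D) → ∃[ 𝒜 ] IsWitness p F 𝒜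
  -- The start is a level past which the tail is within the tolerance; adding `j` makes it at least
  -- `j`.
  lists⇒witness L ∑L≤1 L-hits = tails⇒witness L (λ j m → proj₁ (tail j m) ℕ.+ j) (λ j m → ℕ.m≤n+m j (proj₁ (tail j m)))
    (λ j m K → ≤-trans (proj₂ (tail j m) _ (ℕ.m≤m+n (proj₁ (tail j m)) j) K) (proj₂ (proj₂ (tolerance j m)))) L-hits
    where
    tolerance : ∀ j m → ∃[ ε ] 0ℚ ℚ.< ε × fromℚ ε ≤ᴿ leastWeight p m *ᴿ (θ j *ᴿ θ j)
    tolerance j m = rational-below (0<* (0<leastWeight bias m) (0<* (0<θ j) (0<θ j)))

    tail : ∀ j m → ∃[ M ] ∀ N → M ℕ.≤ N → ∀ K → ∑ (shift N (listWeight p ∘ L)) K ≤ᴿ fromℚ (proj₁ (tolerance j m))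
    tail j m = ∑-tail (λ D → 0≤listWeight bias (L D)) ∑L≤1 (proj₁ (tolerance j m)) (proj₁ (proj₂ (tolerance j m)))

  -- Covers of `F` of weight `θ i` have total weight at most 1. The cover with index `N` catches `X`
  -- on a diagonal not before `N`, so the diagonals catch `X` infinitely often.
  null⇒witness : Null p F → ∃[ 𝒜 ] IsWitness p F 𝒜
  null⇒witness null = lists⇒witness (diagonal C)
    (λ N → ≤-trans (∑-diagonal C (λ i → proj₂ (proj₂ (covers i))) N) (∑θ≤1 N))
    λ X X∈F N → let (i , h) = proj₁ (proj₂ (covers N)) X X∈F in N ℕ.+ i , ℕ.m≤m+n N i , ∈-diagonal C N i h
    where
    covers : ∀ i → CoverBound p F (θ i)
    covers i = null _ (geometric-pos (ℚ.positive⁻¹ 1ℚ) (suc i))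
    C : ℕ → ℕ → Cyl
    C i = proj₁ (covers i)

theorem1p2 : ExcludedMiddle 0ℓ →
    (p : ℕ → ℝ) → (∀ n → 0ᴿ <ᴿ p n × p n ≤ᴿ ½ᴿ) →
    (F : Pred 2^ω 0ℓ) → IsFilter F → ¬ Principal F →
    Measurable p F ⇔ (∃[ 𝒜 ] IsWitness p F 𝒜)
theorem1p2 em p bias F isF nonprincipal = mk⇔
  (λ measurable → null⇒witness em bias isF (measurable⇒null em bias isF measurable nonprincipal))
  (λ (𝒜 , witness) → null⇒measurable (borel-cantelli witness))
  where open Measure em bias
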